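{- $\mathbf{PP}\subseteq\mathbf{NP}^{\mathbf{MNS}}$.
   Context: For a polynomial $p$, a polynomial-time computable predicate $R$ and input $x$, write $N(x)=|\{y : |y|=p(|x|)\wedge R(x,y)\}|$. A language $L$ is in $\mathbf{PP}$ if there exist $p,R$ such that for all $x$: $x\in L\iff N(x)>2^{p(|x|)-1}$. A language $L$ is in $\mathbf{MNS}$ if there exist $p,R$ such that for all $x$: $x\in L\iff N(x)=2^t-1$ for some $t\in\{1,2,3,\dots\}$. $\mathbf{NP}^{\mathbf{MNS}}$ denotes the class of languages decided by nondeterministic polynomial-time oracle Turing machines with an oracle for some language in $\mathbf{MNS}$. -}

module Defs where

open import Data.Nat using (ℕ; zero; suc; _+_; _*_; _^_; _<_; _≤_)
open import Data.Fin using (Fin; zero; suc; _≟_)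
open import Data.Bool using (Bool; true; false; if_then_else_)
open import Data.List using (List; []; _∷_; _++_; map; length; [_])
open import Data.Nat.ListAction using (sum)
open import Data.Maybe using (Maybe; just; nothing)
open import Data.Product using (Σ; _×_; _,_; proj₁; ∃-syntax)
open import Data.Sum using (_⊎_)
open import Data.List.Membership.Propositional using (_∈_)
open import Relation.Binary.PropositionalEquality using (_≡_; _≢_)
open import Relation.Nullary using (¬_)
open import Relation.Nullary.Decidable using (isYes)
open import Function.Bundles using (_⇔_)

Str : Set
Str = List Bool

Language : Set₁
Language = Str → Set

allStrings : ℕ → List Str
allStrings zero    = [ [] ]
allStrings (suc m) = map (false ∷_) (allStrings m) ++ map (true ∷_) (allStrings m)

Poly : Set
Poly = List ℕ

eval : Poly → ℕ → ℕ
eval []       n = 0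
eval (a ∷ as) n = a + n * eval as n

data Move : Set where
  left right stay : Move

Sym : ℕ → Set
Sym k = Fin (4 + k)

blank : ∀ {k} → Sym k
blank = zero

bitSym : ∀ {k} → Bool → Sym k
bitSym false = suc zero
bitSym true  = suc (suc zero)

sepSym : ∀ {k} → Sym k
sepSym = suc (suc (suc zero))

-- (cells left of head, reversed) , head cell , (cells right of head)
Tape : ℕ → Set
Tape k = List (Sym k) × Sym k × List (Sym k)

readT : ∀ {k} → Tape k → Sym k
readT (_ , h , _) = h

writeT : ∀ {k} → Sym k → Tape k → Tape k
writeT s (l , _ , r) = (l , s , r)

moveT : ∀ {k} → Move → Tape k → Tape k
moveT left  ([]    , h , r)     = ([] , blank , h ∷ r)
moveT left  (a ∷ l , h , r)     = (l , a , h ∷ r)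
moveT right (l     , h , [])    = (h ∷ l , blank , [])
moveT right (l     , h , a ∷ r) = (h ∷ l , a , r)
moveT stay  t                   = t

initTape : ∀ {k} → List (Sym k) → Tape k
initTape []      = ([] , blank , [])
initTape (a ∷ w) = ([] , a , w)

enc : ∀ {k} → Str → List (Sym k)
enc = map bitSym

encPair : ∀ {k} → Str → Str → List (Sym k)
encPair x y = enc x ++ sepSym ∷ enc y

record DTM : Set where
  field
    states : ℕ
    alph   : ℕ
    start  : Fin states
    acc    : Fin states
    rej    : Fin states
    δ      : Fin states → Sym alph → Fin states × Sym alph × Move

module _ (M : DTM) where
  open DTM M

  DConf : Set
  DConf = Fin states × Tape alph

  dstep : DConf → DConf
  dstep (q , t) with isYes (q ≟ acc) | isYes (q ≟ rej)
  ... | true  | _     = (q , t)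
  ... | false | true  = (q , t)
  ... | false | false with δ q (readT t)
  ...   | (q' , s , m) = (q' , moveT m (writeT s t))

  drun : ℕ → DConf → DConf
  drun zero    c = c
  drun (suc n) c = drun n (dstep c)

  dinit : List (Sym alph) → DConf
  dinit w = (start , initTape w)

record PTimePred : Set where
  field
    M     : DTM
    bound : Poly
    halts : ∀ x y →
      let w = encPair {DTM.alph M} x y
          q = proj₁ (drun M (eval bound (length w)) (dinit M w))
      in (q ≡ DTM.acc M) ⊎ (q ≡ DTM.rej M)

decideR : PTimePred → Str → Str → Bool
decideR R x y =
  let open PTimePred R
      w = encPair {DTM.alph M} x y
  in isYes (proj₁ (drun M (eval bound (length w)) (dinit M w)) ≟ DTM.acc M)

countN : Poly → PTimePred → Str → ℕ
countN p R x =
  sum (map (λ y → if decideR R x y then 1 else 0) (allStrings (eval p (length x))))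

-- N(x) > 2^(p(|x|)-1)  written without subtraction as  2^p(|x|) < 2·N(x)
PP : Language → Set
PP L = Σ Poly λ p → Σ PTimePred λ R →
  ∀ x → L x ⇔ (2 ^ eval p (length x) < 2 * countN p R x)

-- N(x) = 2^t - 1 for some t ≥ 1, i.e. N(x) + 1 = 2^(suc t) for some t
MNS : Language → Set
MNS L = Σ Poly λ p → Σ PTimePred λ R →
  ∀ x → L x ⇔ (∃[ t ] countN p R x + 1 ≡ 2 ^ suc t)

-- Nondeterministic oracle Turing machines.
-- One work tape (initially holding the input) and a write-only query
-- string; entering the query state replaces the state by qyes / qno
-- according to the oracle and erases the query string.

record ONTM : Set where
  field
    states : ℕ
    alph   : ℕ
    start  : Fin states
    acc    : Fin states
    qry    : Fin states
    qyes   : Fin states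
    qno    : Fin states
    -- each transition: new state, symbol written, head move,
    -- optionally a bit appended to the query string
    δ      : Fin states → Sym alph → List (Fin states × Sym alph × Move × Maybe Bool)

appendQ : Str → Maybe Bool → Str
appendQ w nothing  = w
appendQ w (just b) = w ++ [ b ]

module _ (M : ONTM) (O : Language) where
  open ONTM M

  OConf : Set
  OConf = Fin states × Tape alph × Str

  data OStep : OConf → OConf → Set where
    trans : ∀ {q t w q' s m ob} → q ≢ qry →
            (q' , s , m , ob) ∈ δ q (readT t) →
            OStep (q , t , w) (q' , moveT m (writeT s t) , appendQ w ob)
    ansYes : ∀ {t w} → O w → OStep (qry , t , w) (qyes , t , [])
    ansNo  : ∀ {t w} → ¬ O w → OStep (qry , t , w) (qno , t , [])

  data OSteps : ℕ → OConf → OConf → Set where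
    done : ∀ {c} → OSteps zero c c
    next : ∀ {n c c' c''} → OStep c c' → OSteps n c' c'' → OSteps (suc n) c c''

  AcceptsWithin : ℕ → Str → Set
  AcceptsWithin T x = ∃[ n ] Σ OConf λ c →
    n ≤ T × OSteps n (start , initTape (enc x) , []) c × proj₁ c ≡ acc

NPwith : Language → Language → Set
NPwith A L = Σ ONTM λ M → Σ Poly λ p →
  ∀ x → L x ⇔ AcceptsWithin M A (eval p (length x)) x

NP^MNS : Language → Set₁
NP^MNS L = Σ Language λ A → MNS A × NPwith A L

{-# OPTIONS --safe #-}
module Submission where

-- Let n = p(|x|) and let N, N̄ = 2ⁿ − N count the accepting and rejecting y.  For a guessed m with
-- 2ⁿ⁻¹ ≤ m < 2ⁿ, an oracle predicate with 2ⁿ + m + N̄ witnesses is easy to build from R.  Adding 1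
-- gives a number strictly between 2ⁿ and 2ⁿ⁺², so it is a power of two only if m + N̄ + 1 = 2ⁿ, and a
-- suitable m exists exactly when N̄ < 2ⁿ⁻¹, that is, when N > 2ⁿ⁻¹.
--
-- The oracle machine guesses bits and asks for (1b)* 0 x.  Given such a string and y', the verifier
-- must cut off the first n bits of y'.  It finds n by running p in Horner form as nested loops over
-- the cells of x, each innermost step moving one guessed bit onto the next bit of y'.

open import Defs
open import Data.Bool using (Bool; true; false; not; _∧_; _∨_; if_then_else_)
open import Data.Empty using (⊥)
open import Data.Fin using (Fin; zero; suc; _↑ˡ_; _↑ʳ_; splitAt; _≟_)
open import Data.Fin.Properties using (splitAt-↑ˡ; splitAt-↑ʳ; +↔⊎; *↔×; 0↔⊥; 1↔⊤; 2↔Bool)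
open import Data.List
  using (List; []; _∷_; _++_; [_]; map; length; replicate; reverse; _ʳ++_; foldl; zip; _∷ʳ_)
open import Data.List.Membership.Propositional using (_∈_)
open import Data.List.Properties
  using ( ++-assoc; ++-identityʳ; ++-ʳ++; ʳ++-ʳ++; ∷ʳ-++; map-++; map-∘; map-ʳ++; length-++; length-map
        ; length-replicate; length-reverse; length-ʳ++; reverse-involutive)
open import Data.List.Relation.Binary.Pointwise using (Pointwise; []; _∷_)
open import Data.List.Relation.Unary.All as All using (All; []; _∷_)
open import Data.List.Relation.Unary.All.Properties using (++⁺; map⁺; replicate⁺)
open import Data.List.Relation.Unary.Any using (here; there)
open import Data.Maybe using (Maybe; just; nothing; _>>=_)
open import Data.Nat using (ℕ; zero; suc; _+_; _*_; _^_; _≤_; _<_; z≤n; s≤s; _<?_)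
open import Data.Nat.ListAction using (sum)
open import Data.Nat.ListAction.Properties using (sum-++)
open import Data.Nat.Properties hiding (_≟_; _<?_)
open import Data.Nat.Tactic.RingSolver using (solve-∀)
open import Data.Product using (Σ; ∃; ∃-syntax; _×_; _,_; proj₁; proj₂)
open import Data.Product.Function.NonDependent.Propositional using (_×-↔_)
open import Data.Sum using (_⊎_; inj₁; inj₂; [_,_]′)
open import Data.Sum.Function.Propositional using (_⊎-↔_)
open import Data.Unit using (⊤; tt)
open import Function using (_∘_; id; case_of_)
open import Function.Bundles using (_↔_; Inverse; mk⇔; Equivalence)
open import Function.Properties.Inverse using (↔-refl; ↔-sym; ↔-trans)
open import Relation.Binary.Definitions using (tri<; tri≈; tri>)
open import Relation.Binary.PropositionalEquality
  using (_≡_; _≢_; refl; sym; cong; cong₂; subst; subst₂; module ≡-Reasoning)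
  renaming (trans to ≡-trans)
open import Relation.Nullary using (yes; no; contradiction)
open import Relation.Nullary.Decidable using (isYes; isYes≗does; dec-true)

-- Turing machines with structured states and symbols

-- The summand 2ⁿ excludes a false power of two: with m + N̄ witnesses alone, m = 2ⁿ - 1 and N̄ = 2ⁿ
-- would give 2ⁿ⁺¹ after adding 1, although N = 0. The lower bound on m is what turns an exact guess
-- N = m + 1 into a majority test.
--
-- The oracle machine does not evaluate p and guesses any number of bits. With fewer than n, no y'
-- is accepted, and 0 + 1 = 2⁰ does not count because the exponent in `MNS` is positive. With more
-- than n, the verifier uses the last n. The guessed bits also pad the query: p(|x|) is not
-- determined by the query's length, but that length is at least n once enough bits are guessed, so
-- a y' two longer than the query has room for y and a tag.
--
-- The verifier has a single tape.

Finite : Set → Set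
Finite A = ∃ λ n → A ↔ Fin n

module FiniteControl
  {Ctrl Extra : Set} (k : ℕ) (ctrl : Finite Ctrl) (extra : Finite Extra)
  (δ : Ctrl → Sym k ⊎ Extra → (Ctrl ⊎ Bool) × (Sym k ⊎ Extra) × Move)
  (start : Ctrl)
  where

  A State : Set
  A     = Sym k ⊎ Extra
  State = Ctrl ⊎ Bool

  private
    nC = proj₁ ctrl
    nE = proj₁ extra
    module C = Inverse (proj₂ ctrl)
    module E = Inverse (proj₂ extra)

  -- Base symbols keep their index, so blank, bits and separator are encoded exactly as in an
  -- ordinary input.
  encA : A → Sym (k + nE)
  encA (inj₁ s) = s ↑ˡ nE
  encA (inj₂ x) = (4 + k) ↑ʳ E.to x

  decA : Sym (k + nE) → A
  decA i with splitAt (4 + k) i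
  ... | inj₁ s = inj₁ s
  ... | inj₂ j = inj₂ (E.from j)

  decA-encA : ∀ a → decA (encA a) ≡ a
  decA-encA (inj₁ s) rewrite splitAt-↑ˡ (4 + k) s nE = refl
  decA-encA (inj₂ x) rewrite splitAt-↑ʳ (4 + k) nE (E.to x) = cong inj₂ (E.strictlyInverseʳ x)

  encS : State → Fin (2 + nC)
  encS (inj₂ true)  = zero
  encS (inj₂ false) = suc zero
  encS (inj₁ q)     = suc (suc (C.to q))

  encode : State × A × Move → Fin (2 + nC) × Sym (k + nE) × Move
  encode (s , a , m) = encS s , encA a , m

  machine : DTM
  machine = record
    { states = 2 + nC
    ; alph   = k + nE
    ; start  = encS (inj₁ start)
    ; acc    = zero
    ; rej    = suc zero
    ; δ      = λ { (suc (suc i)) a → encode (δ (C.from i) (decA a))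
                 ; i             a → i , a , stay }
    }

  ATape : Set
  ATape = List A × A × List A

  blankA : A
  blankA = inj₁ blank

  at : List A → List A → ATape
  at l []      = l , blankA , []
  at l (a ∷ r) = l , a , r

  moveA : Move → ATape → ATape
  moveA left  ([]    , h , r) = [] , blankA , h ∷ r
  moveA left  (a ∷ l , h , r) = l , a , h ∷ r
  moveA right (l     , h , r) = at (h ∷ l) r
  moveA stay  t               = t

  encT : ATape → Tape (k + nE)
  encT (l , h , r) = map encA l , encA h , map encA r

  moveT-encT : ∀ m t → moveT m (encT t) ≡ encT (moveA m t)
  moveT-encT left  ([]    , h , r)     = refl
  moveT-encT left  (a ∷ l , h , r)     = refl
  moveT-encT right (l     , h , [])    = refl
  moveT-encT right (l     , h , a ∷ r) = refl
  moveT-encT stay  t                   = refl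

  initTape-encA : ∀ w → initTape (map encA w) ≡ encT (at [] w)
  initTape-encA []      = refl
  initTape-encA (a ∷ w) = refl

  dstep-enc : ∀ {q l a r s a' m} → δ q a ≡ (s , a' , m) →
    dstep machine (encS (inj₁ q) , encT (l , a , r)) ≡ (encS s , encT (moveA m (l , a' , r)))
  dstep-enc {q} {l} {a} {r} {s} {a'} {m} eq
    rewrite decA-encA a | C.strictlyInverseʳ q | eq
    = cong (encS s ,_) (moveT-encT m (l , a' , r))

  -- Demanding the answer at every time from T on makes T freely weakenable (`mono`). The run lemmas
  -- reason backwards, from a later configuration that halts to an earlier one, adding up the steps.
  record Halts (T : ℕ) (s : State) (t : ATape) (b : Bool) : Set where
    constructor halts
    field result : ∀ n → T ≤ n → proj₁ (drun machine n (encS s , encT t)) ≡ encS (inj₂ b)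

  halted : ∀ {t} b → Halts 0 (inj₂ b) t b
  halted {t} b = halts (λ n _ → stays {t} b n)
    where
    stays : ∀ {t} b n → proj₁ (drun machine n (encS (inj₂ b) , encT t)) ≡ encS (inj₂ b)
    stays     b     zero    = refl
    stays {t} true  (suc n) = stays {t} true n
    stays {t} false (suc n) = stays {t} false n

  mono : ∀ {T T' s t b} → T ≤ T' → Halts T s t b → Halts T' s t b
  mono T≤T' (halts H) = halts λ n T'≤n → H n (≤-trans T≤T' T'≤n)

  step : ∀ {T q l a r b s a' m} → δ q a ≡ (s , a' , m) →
    Halts T s (moveA m (l , a' , r)) b → Halts (suc T) (inj₁ q) (l , a , r) b
  step {l = l} {a} {r} {m = m} eq (halts H) = halts λ where
    (suc n) (s≤s T≤n) →
      ≡-trans (cong (proj₁ ∘ drun machine n) (dstep-enc {l = l} {a} {r} {m = m} eq)) (H n T≤n)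

  Skips : Ctrl → Move → A → Set
  Skips q m a = δ q a ≡ (inj₁ q , a , m)

  scanˡ : ∀ {T q₀ q h h' l z r b} u → δ q₀ h ≡ (inj₁ q , h' , left) → All (Skips q left) u →
    Halts T (inj₁ q) (l , z , u ʳ++ (h' ∷ r)) b →
    Halts (suc (length u) + T) (inj₁ q₀) (u ++ z ∷ l , h , r) b
  scanˡ []      eq []       H = step eq H
  scanˡ (a ∷ u) eq (e ∷ es) H = step eq (scanˡ u e es H)

  scanʳ : ∀ {T q₀ q h h' l z r b} u → δ q₀ h ≡ (inj₁ q , h' , right) → All (Skips q right) u →
    Halts T (inj₁ q) (u ʳ++ (h' ∷ l) , z , r) b →
    Halts (suc (length u) + T) (inj₁ q₀) (l , h , u ++ z ∷ r) b
  scanʳ []      eq []       H = step eq H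
  scanʳ (a ∷ u) eq (e ∷ es) H = step eq (scanʳ u e es H)

  module _ {q₀ q : Ctrl} {z z' : A} where

    -- The return of a sweep: the outward sweep has left u reversed on the other side, hence `ʳ++`.
    -- Cells may be rewritten on the way, which the clearing of marks needs in `rescanʳ`.
    rescanˡ : ∀ {T l h r b u u'} → δ q₀ z ≡ (inj₁ q , z' , left) →
      Pointwise (λ a a' → δ q a ≡ (inj₁ q , a' , left)) u u' →
      Halts T (inj₁ q) (l , h , u' ++ z' ∷ r) b →
      Halts (suc (length u) + T) (inj₁ q₀) (u ʳ++ (h ∷ l) , z , r) b
    rescanˡ {u = []}    eq []       H = step eq H
    rescanˡ {T} {u = a ∷ u} eq (e ∷ es) H
      rewrite sym (+-suc (length u) T) = rescanˡ eq es (step e H)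

    rescanʳ : ∀ {T l h r b u u'} → δ q₀ z ≡ (inj₁ q , z' , right) →
      Pointwise (λ a a' → δ q a ≡ (inj₁ q , a' , right)) u u' →
      Halts T (inj₁ q) (u' ++ z' ∷ l , h , r) b →
      Halts (suc (length u) + T) (inj₁ q₀) (l , z , u ʳ++ (h ∷ r)) b
    rescanʳ {u = []}    eq []       H = step eq H
    rescanʳ {T} {u = a ∷ u} eq (e ∷ es) H
      rewrite sym (+-suc (length u) T) = rescanʳ eq es (step e H)

  -- A sweep that misses its target: beyond the last written cell the tape supplies a blank, which
  -- triggers the answer.
  failˡ : ∀ {q₀ q h h' r b a' m} u → δ q₀ h ≡ (inj₁ q , h' , left) → All (Skips q left) u →
    δ q blankA ≡ (inj₂ b , a' , m) → Halts (2 + length u) (inj₁ q₀) (u , h , r) b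
  failˡ []      eq []       e' = step eq (step e' (halted _))
  failˡ (a ∷ u) eq (e ∷ es) e' = step eq (failˡ u e es e')

  failʳ : ∀ {q₀ q h h' l b a' m} u → δ q₀ h ≡ (inj₁ q , h' , right) → All (Skips q right) u →
    δ q blankA ≡ (inj₂ b , a' , m) → Halts (2 + length u) (inj₁ q₀) (l , h , u) b
  failʳ []      eq []       e' = step eq (step e' (halted _))
  failʳ (a ∷ u) eq (e ∷ es) e' = step eq (failʳ u e es e')

-- The transition table of the verifier

Fin-finite : ∀ n → Finite (Fin n)
Fin-finite n = n , ↔-refl

⊥-finite : Finite ⊥
⊥-finite = 0 , ↔-sym 0↔⊥

⊤-finite : Finite ⊤
⊤-finite = 1 , ↔-sym 1↔⊤

Bool-finite : Finite Bool
Bool-finite = 2 , ↔-sym 2↔Bool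

infixr 5 _⊎-finite_ _×-finite_

_⊎-finite_ : ∀ {A B} → Finite A → Finite B → Finite (A ⊎ B)
(m , f) ⊎-finite (n , g) = m + n , ↔-trans (f ⊎-↔ g) (↔-sym +↔⊎)

_×-finite_ : ∀ {A B} → Finite A → Finite B → Finite (A × B)
(m , f) ×-finite (n , g) = m * n , ↔-trans (f ×-↔ g) (↔-sym *↔×)

-- One mark per loop of the program; the loop with body c uses the mark with index length c.
Marks : ℕ → Set
Marks zero    = ⊤
Marks (suc d) = Bool × Marks d

Marks-finite : ∀ d → Finite (Marks d)
Marks-finite zero    = ⊤-finite
Marks-finite (suc d) = Bool-finite ×-finite Marks-finite d

noMarks : ∀ {d} → Marks d
noMarks {zero}  = tt
noMarks {suc d} = false , noMarks

get : ∀ {d} → ℕ → Marks d → Bool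
get {zero}  _       _       = false
get {suc d} zero    (v , _) = v
get {suc d} (suc i) (_ , m) = get i m

set : ∀ {d} → ℕ → Bool → Marks d → Marks d
set {zero}  _       _ m       = m
set {suc d} zero    w (_ , m) = w , m
set {suc d} (suc i) w (v , m) = v , set i w m

get-noMarks : ∀ d i → get i (noMarks {d}) ≡ false
get-noMarks zero    i       = refl
get-noMarks (suc d) zero    = refl
get-noMarks (suc d) (suc i) = get-noMarks d i

get-set-≡ : ∀ {d} i w (m : Marks d) → i < d → get i (set i w m) ≡ w
get-set-≡ {suc d} zero    w m       _         = refl
get-set-≡ {suc d} (suc i) w (_ , m) (s≤s i<d) = get-set-≡ i w m i<d

get-set-< : ∀ {d} i j w (m : Marks d) → j < i → get j (set i w m) ≡ get j m
get-set-< {zero}  i       j       w m       _         = refl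
get-set-< {suc d} (suc i) zero    w m       _         = refl
get-set-< {suc d} (suc i) (suc j) w (_ , m) (s≤s j<i) = get-set-< i j w m j<i

set-undo : ∀ {d} i (m : Marks d) → get i m ≡ false → set i false (set i true m) ≡ m
set-undo {zero}  i       m       _  = refl
set-undo {suc d} zero    (_ , m) eq = cong (_, m) (sym eq)
set-undo {suc d} (suc i) (v , m) eq = cong (v ,_) (set-undo i m eq)

-- A loop repeats all of the code after it, once for each cell of x.
data Instr : Set where
  emit loop : Instr

Code : Set
Code = List Instr

count : Code → ℕ → ℕ
count []         n = 0
count (emit ∷ c) n = suc (count c n)
count (loop ∷ c) n = n * count c n

code : Poly → Code
code []       = []
code (a ∷ as) = replicate a emit ++ loop ∷ code as

count-code : ∀ p n → count (code p) n ≡ eval p n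
count-code []       n = refl
count-code (a ∷ as) n = go a
  where
  go : ∀ a → count (replicate a emit ++ loop ∷ code as) n ≡ a + n * eval as n
  go zero    = cong (n *_) (count-code as n)
  go (suc a) = cong suc (go a)

-- The control remembers the current instruction, so its size is fixed by p, while the loop counters
-- stay on the tape.
Local : Code → Set
Local []         = ⊥
Local (emit ∷ c) = (Fin 2 ⊎ Bool) ⊎ Local c
Local (loop ∷ c) = Fin 3 ⊎ Local c

Local-finite : ∀ c → Finite (Local c)
Local-finite []         = ⊥-finite
Local-finite (emit ∷ c) = (Fin-finite 2 ⊎-finite Bool-finite) ⊎-finite Local-finite c
Local-finite (loop ∷ c) = Fin-finite 3 ⊎-finite Local-finite c

pattern seek    = inj₁ (inj₁ zero)
pattern home    = inj₁ (inj₁ (suc zero))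
pattern carry b = inj₁ (inj₂ b)

pattern find    = inj₁ zero
pattern enter   = inj₁ (suc zero)
pattern clear   = inj₁ (suc (suc zero))

-- emb embeds the control states of the code into those of the whole machine; ret is where the
-- machine continues when the code is finished.
entry : ∀ {S : Set} c → (Local c → S) → S → S
entry []         emb ret = ret
entry (emit ∷ c) emb ret = emb seek
entry (loop ∷ c) emb ret = emb find

-- The flag decides whether the first 1 of y stands over a guessed bit 1, with the first guessed bit
-- read as 1; over all y of length n this happens for exactly m of them, 2ⁿ⁻¹ ≤ m < 2ⁿ.
Flag : Set
Flag = Fin 2 ⊎ Bool

pattern first = inj₁ zero
pattern unset = inj₁ (suc zero)
pattern set! b = inj₂ b

update : Flag → Bool × Bool → Flag
update first    (true  , _) = set! true
update first    (false , _) = unset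
update unset    (true  , b) = set! b
update unset    (false , _) = unset
update (set! v) _           = set! v

isSet : Flag → Bool
isSet (set! v) = v
isSet _        = false

pattern simulate = inj₁ zero
pattern answer v = inj₂ v

-- D is an erased cell, K a guessed bit not yet used, X a bit of x with its marks, and Y c b a bit c
-- of y over which the guessed bit b has been put.
pattern blk   = inj₁ zero
pattern 𝟎     = inj₁ (suc zero)
pattern 𝟏     = inj₁ (suc (suc zero))
pattern ♯     = inj₁ (suc (suc (suc zero)))
pattern D     = inj₂ (inj₁ tt)
pattern K b   = inj₂ (inj₂ (inj₁ b))
pattern X b m = inj₂ (inj₂ (inj₂ (inj₁ (b , m))))
pattern Y c b = inj₂ (inj₂ (inj₂ (inj₂ (c , b))))

-- Number of extra erased cells, unused guessed bits, paired bits of y, remaining bits of y'.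
Stock : Set
Stock = ℕ × List Bool × List (Bool × Bool) × List Bool

-- The effect of one `emit`. The cell of the used bit and the D behind it both join the erased block
-- next to x, hence 2 + j.
transfer : Stock → Maybe Stock
transfer (j , b ∷ ms , ys , c ∷ raw) = just (2 + j , ms , ys ∷ʳ (c , b) , raw)
transfer _                           = nothing

iter : ℕ → Stock → Maybe Stock
iter zero    σ = just σ
iter (suc k) σ = transfer σ >>= iter k

iter-+ : ∀ a b σ → iter (a + b) σ ≡ (iter a σ >>= iter b)
iter-+ zero    b σ = refl
iter-+ (suc a) b σ with transfer σ
... | nothing = refl
... | just σ' = iter-+ a b σ'

module Verifier (M : DTM) (c₀ : Code) where

  module M = DTM M

  d = length c₀

  Extra : Set
  Extra = ⊤ ⊎ Bool ⊎ (Bool × Marks d) ⊎ (Bool × Bool)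

  Extra-finite : Finite Extra
  Extra-finite = ⊤-finite ⊎-finite Bool-finite ⊎-finite (Bool-finite ×-finite Marks-finite d)
                 ⊎-finite (Bool-finite ×-finite Bool-finite)

  Symbol : Set
  Symbol = Sym M.alph ⊎ Extra

  Ctrl : Set
  Ctrl = Fin 4 ⊎ Local c₀ ⊎ Flag ⊎ Bool ⊎ (Fin 1 ⊎ Bool) ⊎ Fin M.states

  Ctrl-finite : Finite Ctrl
  Ctrl-finite =
    Fin-finite 4 ⊎-finite Local-finite c₀ ⊎-finite (Fin-finite 2 ⊎-finite Bool-finite)
    ⊎-finite Bool-finite ⊎-finite (Fin-finite 1 ⊎-finite Bool-finite) ⊎-finite Fin-finite M.states

  pattern parse₀    = inj₁ zero
  pattern parse₁    = inj₁ (suc zero)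
  pattern convert   = inj₁ (suc (suc zero))
  pattern rewind    = inj₁ (suc (suc (suc zero)))
  pattern running q = inj₂ (inj₁ q)
  pattern check f   = inj₂ (inj₂ (inj₁ f))
  pattern tag v     = inj₂ (inj₂ (inj₂ (inj₁ v)))
  pattern zeros w   = inj₂ (inj₂ (inj₂ (inj₂ (inj₁ w))))
  pattern sim q     = inj₂ (inj₂ (inj₂ (inj₂ (inj₂ q))))

  Outcome : Set
  Outcome = (Ctrl ⊎ Bool) × Symbol × Move

  reject : Symbol → Outcome
  reject a = inj₂ false , a , stay

  -- A loop has marked the cells of x already treated, those nearest to ♯ first.
  runStep : ∀ c → (Local c → Ctrl) → Ctrl → Local c → Symbol → Outcome
  runStep (emit ∷ c) emb ret seek (K b)    = inj₁ (emb (carry b)) , D , right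
  runStep (emit ∷ c) emb ret seek blk      = reject blk
  runStep (emit ∷ c) emb ret seek a        = inj₁ (emb seek) , a , left
  runStep (emit ∷ c) emb ret (carry b) 𝟎   = inj₁ (emb home) , Y false b , left
  runStep (emit ∷ c) emb ret (carry b) 𝟏   = inj₁ (emb home) , Y true b , left
  runStep (emit ∷ c) emb ret (carry b) blk = reject blk
  runStep (emit ∷ c) emb ret (carry b) a   = inj₁ (emb (carry b)) , a , right
  runStep (emit ∷ c) emb ret home ♯        = inj₁ (entry c (emb ∘ inj₂) ret) , ♯ , stay
  runStep (emit ∷ c) emb ret home a        = inj₁ (emb home) , a , left
  runStep (emit ∷ c) emb ret (inj₂ q) a    = runStep c (emb ∘ inj₂) ret q a
  runStep (loop ∷ c) emb ret find (X b m)  =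
    if get (length c) m
    then inj₁ (emb find) , X b m , left
    else inj₁ (emb enter) , X b (set (length c) true m) , right
  -- D lies just beyond the last cell of x, so all cells have been treated.
  runStep (loop ∷ c) emb ret find D        = inj₁ (emb clear) , D , right
  runStep (loop ∷ c) emb ret find a        = inj₁ (emb find) , a , left
  runStep (loop ∷ c) emb ret enter ♯       = inj₁ (entry c (emb ∘ inj₂) (emb find)) , ♯ , stay
  runStep (loop ∷ c) emb ret enter a       = inj₁ (emb enter) , a , right
  runStep (loop ∷ c) emb ret clear (X b m) =
    inj₁ (emb clear) , X b (set (length c) false m) , right
  runStep (loop ∷ c) emb ret clear a       = inj₁ ret , a , stay
  runStep (loop ∷ c) emb ret (inj₂ q) a    = runStep c (emb ∘ inj₂) (emb find) q a

  view : Symbol → Sym M.alph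
  view (inj₁ s) = s
  view D        = blank
  view (K _)    = blank
  view (X b _)  = bitSym b
  view (Y c _)  = bitSym c

  continue : Fin M.states × Sym M.alph × Move → Outcome
  continue (q , s , m) = inj₁ (sim q) , inj₁ s , m

  simStep : Fin M.states → Symbol → Outcome
  simStep q a =
    -- The answers are exchanged: the witnesses to be counted are the rejecting y.
    if isYes (q ≟ M.acc) then inj₂ false , a , stay
    else if isYes (q ≟ M.rej) then inj₂ true , a , stay
    else continue (M.δ q (view a))

  δ : Ctrl → Symbol → Outcome
  δ parse₀ 𝟏                 = inj₁ parse₁ , D , right
  δ parse₀ 𝟎                 = inj₁ convert , D , right
  δ parse₁ 𝟎                 = inj₁ parse₀ , K false , right
  δ parse₁ 𝟏                 = inj₁ parse₀ , K true , right
  δ convert 𝟎                = inj₁ convert , X false noMarks , right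
  δ convert 𝟏                = inj₁ convert , X true noMarks , right
  δ convert ♯                = inj₁ (entry c₀ (λ q → running q) (check first)) , ♯ , stay
  -- The D nearest x stands where the delimiter 0 was, so it is present even if no bit was guessed.
  δ rewind D                 = inj₁ (sim M.start) , D , right
  δ rewind a                 = inj₁ rewind , a , left
  δ (running q) a            = runStep c₀ (λ q → running q) (check first) q a
  δ (check f) ♯              = inj₁ (check f) , ♯ , right
  δ (check f) (Y c b)        = inj₁ (check (update f (c , b))) , Y c b , right
  -- From here on the tail is wiped, so that the machine for R sees only blanks after y.
  δ (check f) 𝟎              = inj₁ (zeros simulate) , blk , right
  δ (check f) 𝟏              = inj₁ (tag (isSet f)) , blk , right
  δ (tag v) 𝟎                = inj₁ (zeros (answer v)) , blk , right
  δ (tag v) 𝟏                = inj₁ (zeros (answer true)) , blk , right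
  δ (zeros w) 𝟎              = inj₁ (zeros w) , blk , right
  δ (zeros simulate) blk     = inj₁ rewind , blk , left
  δ (zeros (answer v)) blk   = inj₂ v , blk , stay
  δ (sim q) a                = simStep q a
  δ _ a                      = reject a

-- Correctness and running time of the verifier

-- W bounds the length of a sweep over the tape and T is the time left for what follows.
budget : Code → ℕ → ℕ → ℕ → ℕ
rounds : Code → ℕ → ℕ → ℕ → ℕ → ℕ
budget []         W n T = T
budget (emit ∷ c) W n T = W + (W + (W + (W + (W + budget c W n T))))
budget (loop ∷ c) W n T = rounds c W n n T
rounds c W n zero    T = W + (W + (W + T))
rounds c W n (suc k) T = W + (W + (W + budget c W n (rounds c W n k T)))

module Run (M : DTM) (c₀ : Code) where

  open Verifier M c₀ public
  open FiniteControl M.alph Ctrl-finite Extra-finite δ parse₀ public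

  Cell : Set
  Cell = Bool × Marks d

  cell : Cell → Symbol
  cell (b , m) = X b m

  bit : Bool → Symbol
  bit b = inj₁ (bitSym b)

  pair : Bool × Bool → Symbol
  pair (c , b) = Y c b

  weave : List Bool → List Symbol
  weave []       = []
  weave (b ∷ ms) = K b ∷ D ∷ weave ms

  lead : List Cell → ℕ → List Symbol
  lead cs j = map cell cs ++ replicate (suc j) D

  tape : List Cell → Stock → ATape
  tape cs (j , ms , ys , raw) = lead cs j ++ weave ms , ♯ , map pair ys ++ map bit raw

  -- One bound for each side of ♯. The right one also includes |x|, because the final rewinding
  -- crosses y and x in one sweep. Both sums are invariant under `transfer`.
  Fits : ℕ → ℕ → Stock → Set
  Fits W n (j , ms , ys , raw) = n + (suc j + length (weave ms)) < W × n + (length ys + length raw) < W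

  transfer-fits : ∀ {W n} σ {σ'} → Fits W n σ → transfer σ ≡ just σ' → Fits W n σ'
  transfer-fits {W} {n} (j , b ∷ ms , ys , c ∷ raw) (f , g) refl =
    subst (λ e → n + suc e < W) (≡-trans (+-suc j _) (cong suc (+-suc j _))) f ,
    subst (λ e → n + e < W) (≡-trans (sym (+-assoc (length ys) 1 (length raw)))
                              (cong (_+ length raw) (sym (length-++ ys)))) g

  replicate-shift : ∀ {A : Set} j (x : A) l → replicate j x ++ x ∷ l ≡ x ∷ replicate j x ++ l
  replicate-shift zero    x l = refl
  replicate-shift (suc j) x l = cong (x ∷_) (replicate-shift j x l)

  lead-extend : ∀ cs j l → lead cs j ++ D ∷ D ∷ l ≡ lead cs (2 + j) ++ l
  lead-extend cs j l =
    ≡-trans (++-assoc (map cell cs) _ _)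
      (≡-trans (cong (λ r → map cell cs ++ D ∷ r)
                 (≡-trans (replicate-shift j D (D ∷ l)) (cong (D ∷_) (replicate-shift j D l))))
        (sym (++-assoc (map cell cs) _ _)))

  length-lead : ∀ cs j → length (lead cs j) ≡ length cs + suc j
  length-lead cs j =
    ≡-trans (length-++ (map cell cs)) (cong₂ _+_ (length-map cell cs) (length-replicate (suc j)))

  cells-all : ∀ {P : Symbol → Set} cs → (∀ b m → P (X b m)) → All P (map cell cs)
  cells-all cs p = map⁺ (All.universal (λ _ → p _ _) cs)

  pairs-all : ∀ {P : Symbol → Set} ys → (∀ c b → P (Y c b)) → All P (map pair ys)
  pairs-all ys p = map⁺ (All.universal (λ _ → p _ _) ys)

  lead-all : ∀ {P : Symbol → Set} cs j → (∀ b m → P (X b m)) → P D → All P (lead cs j)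
  lead-all cs j p q = ++⁺ (cells-all cs p) (replicate⁺ (suc j) q)

  unchanged : ∀ {P : Symbol → Symbol → Set} {u} → All (λ a → P a a) u → Pointwise P u u
  unchanged []       = []
  unchanged (e ∷ es) = e ∷ unchanged es

  Embeds : ∀ c → (Local c → Ctrl) → Ctrl → Set
  Embeds c emb ret = ∀ q a → δ (emb q) a ≡ runStep c emb ret q a

  -- What must be known about the continuation: a failed transfer has already rejected, so the
  -- answer is false; otherwise the machine has to halt from the resulting tape.
  After : ℕ → ℕ → ℕ → Ctrl → List Cell → Bool → Maybe Stock → Set
  After W n T q cs b nothing  = b ≡ false
  After W n T q cs b (just σ) = Fits W n σ → Halts T (inj₁ q) (tape cs σ) b

  carry-bit : ∀ {c emb ret} → Embeds (emit ∷ c) emb ret → ∀ v b →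
    δ (emb (carry v)) (bit b) ≡ (inj₁ (emb home) , Y b v , left)
  carry-bit E v false = E _ _
  carry-bit E v true  = E _ _

  fetch : ∀ {W T b c emb ret r} → Embeds (emit ∷ c) emb ret → ∀ cs j v l →
    length cs + suc j < W →
    Halts T (inj₁ (emb (carry v))) (lead cs j ++ D ∷ l , ♯ , r) b →
    Halts (W + (W + T)) (inj₁ (emb seek)) (lead cs j ++ K v ∷ l , ♯ , r) b
  fetch {W} {T} E cs j v l f H =
    mono (+-mono-≤ u<W (+-monoˡ-≤ T u<W))
      (scanˡ u (E _ _) (lead-all cs j (λ _ _ → E _ _) (E _ _))
        (rescanʳ {u = u} (E _ _) (unchanged (lead-all cs j (λ _ _ → E _ _) (E _ _))) H))
    where
    u = lead cs j
    u<W : length u < W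
    u<W = subst (_< W) (sym (length-lead cs j)) f

  deposit : ∀ {W T b c emb ret l} → Embeds (emit ∷ c) emb ret → ∀ ys x v raw →
    length ys < W →
    Halts T (inj₁ (entry c (emb ∘ inj₂) ret)) (l , ♯ , map pair (ys ∷ʳ (x , v)) ++ map bit raw) b →
    Halts (W + (W + suc T)) (inj₁ (emb (carry v))) (l , ♯ , map pair ys ++ bit x ∷ map bit raw) b
  deposit {W} {T} {b} {l = l} E ys x v raw f H =
    mono (+-mono-≤ u<W (+-monoˡ-≤ (suc T) u<W))
      (scanʳ u (E _ _) (pairs-all ys (λ _ _ → E _ _))
        (rescanˡ {u = u} (carry-bit E v x) (unchanged (pairs-all ys (λ _ _ → E _ _)))
          (step (E _ _) (subst (λ r → Halts T _ (l , ♯ , r) b) shift H))))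
    where
    u = map pair ys
    u<W : length u < W
    u<W = subst (_< W) (sym (length-map pair ys)) f
    shift : map pair (ys ∷ʳ (x , v)) ++ map bit raw ≡ map pair ys ++ Y x v ∷ map bit raw
    shift = ≡-trans (cong (_++ map bit raw) (map-++ pair ys _)) (++-assoc (map pair ys) _ _)

  -- Two sweeps fetch the guessed bit and two deposit it; the fifth W pays for the single step at ♯.
  -- If guessed bits or bits of y' have run out, a sweep meets a blank and rejects.
  transfer-halts : ∀ {W T b} c {emb ret} → Embeds (emit ∷ c) emb ret → ∀ cs σ →
    Fits W (length cs) σ → After W (length cs) T (entry c (emb ∘ inj₂) ret) cs b (transfer σ) →
    Halts (W + (W + (W + (W + (W + T))))) (inj₁ (emb seek)) (tape cs σ) b
  transfer-halts {W} {T} c {emb} E cs (j , [] , ys , raw) (f , g) refl =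
    mono (≤-trans (+-mono-≤ (≤-trans (s≤s z≤n) u<W) u<W) (+-monoʳ-≤ W (m≤m+n W _)))
      (failˡ u (E _ _) (++⁺ (lead-all cs j (λ _ _ → E _ _) (E _ _)) []) (E _ _))
    where
    u = lead cs j ++ []
    u<W : length u < W
    u<W = subst (_< W) (sym (≡-trans (cong length (++-identityʳ (lead cs j))) (length-lead cs j)))
            (subst (λ e → length cs + suc e < W) (+-identityʳ j) f)
  transfer-halts {W} {T} c E cs (j , v ∷ ms , ys , []) (f , g) refl =
    fetch E cs j v (D ∷ weave ms) (≤-trans (s≤s (+-monoʳ-≤ (length cs) (m≤m+n (suc j) _))) f)
      (mono (≤-trans (+-mono-≤ (≤-trans (s≤s z≤n) u<W) u<W) (+-monoʳ-≤ W (m≤m+n W _)))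
        (failʳ u (E _ _) (++⁺ (pairs-all ys (λ _ _ → E _ _)) []) (E _ _)))
    where
    u = map pair ys ++ []
    u<W : length u < W
    u<W = subst (_< W) (sym (≡-trans (length-++ (map pair ys)) (cong (_+ 0) (length-map pair ys))))
            (≤-trans (s≤s (m≤n+m _ (length cs))) g)
  transfer-halts {W} {T} {b} c E cs (j , v ∷ ms , ys , x ∷ raw) (f , g) after =
    fetch E cs j v (D ∷ weave ms) (≤-trans (s≤s (+-monoʳ-≤ (length cs) (m≤m+n (suc j) _))) f)
      (mono (+-monoʳ-≤ W (+-monoʳ-≤ W (+-monoˡ-≤ T (≤-trans (s≤s z≤n) f))))
        (deposit E ys x v raw (≤-trans (s≤s (≤-trans (m≤m+n _ _) (m≤n+m _ (length cs)))) g)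
          (subst (λ l → Halts T _ (l , ♯ , _) b) (sym (lead-extend cs j (weave ms)))
            (after (transfer-fits (j , v ∷ ms , ys , x ∷ raw) (f , g) refl)))))

  mark : ℕ → Cell → Cell
  mark i (b , m) = b , set i true m

  -- The loops inside a code of length i use the marks below i; the marks from i on may be in use by
  -- enclosing loops.
  Clear : ℕ → Cell → Set
  Clear i (_ , m) = ∀ j → j < i → get j m ≡ false

  mark-clear : ∀ {i} x → Clear (suc i) x → Clear i (mark i x)
  mark-clear {i} (b , m) cl j j<i = ≡-trans (get-set-< i j true m j<i) (cl j (m≤n⇒m≤1+n j<i))

  marks-clear : ∀ {i cs} → All (Clear (suc i)) cs → All (Clear i) (map (mark i) cs)
  marks-clear cls = map⁺ (All.map (λ {x} → mark-clear x) cls)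

  lead-++ : ∀ as bs j l → lead (as ++ bs) j ++ l ≡ map cell as ++ (lead bs j ++ l)
  lead-++ as bs j l =
    ≡-trans (++-assoc (map cell (as ++ bs)) _ l)
      (≡-trans (cong (_++ (replicate (suc j) D ++ l)) (map-++ cell as bs))
        (≡-trans (++-assoc (map cell as) _ _)
          (cong (map cell as ++_) (sym (++-assoc (map cell bs) _ l)))))

  module Loop {c emb ret} (E : Embeds (loop ∷ c) emb ret) (c<d : length c < d) where

    i = length c

    marked : List Cell → List Symbol
    marked seen = map cell (map (mark i) seen)

    marked-skips : ∀ seen → All (Skips (emb find) left) (marked seen)
    marked-skips seen = map⁺ (map⁺ (All.universal skip seen))
      where
      skip : ∀ x → Skips (emb find) left (cell (mark i x))
      skip (b , m) with E find (X b (set i true m))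
      ... | eq rewrite get-set-≡ i true m c<d = eq

    marked-clears : ∀ {seen} → All (Clear (suc i)) seen →
      Pointwise (λ a a' → δ (emb clear) a ≡ (inj₁ (emb clear) , a' , right))
        (marked seen) (map cell seen)
    marked-clears []                         = []
    marked-clears {(b , m) ∷ _} (cl ∷ cls) =
      ≡-trans (E clear _)
        (cong (λ m' → inj₁ (emb clear) , X b m' , right) (set-undo i m (cl i ≤-refl)))
      ∷ marked-clears cls

    find-unmarked : ∀ x → Clear (suc i) x →
      δ (emb find) (cell x) ≡ (inj₁ (emb enter) , cell (mark i x) , right)
    find-unmarked (b , m) cl with E find (X b m)
    ... | eq rewrite cl i ≤-refl = eq

    length-marked : ∀ {W} seen → length seen < W → length (marked seen) < W
    length-marked {W} seen =
      subst (_< W) (sym (≡-trans (length-map cell (map (mark i) seen)) (length-map (mark i) seen)))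

    advance : ∀ {W T r b} seen z l → Clear (suc i) z → length seen < W →
      Halts T (inj₁ (entry c (emb ∘ inj₂) (emb find))) (marked seen ++ cell (mark i z) ∷ l , ♯ , r) b →
      Halts (W + (W + (W + T))) (inj₁ (emb find)) (marked seen ++ cell z ∷ l , ♯ , r) b
    advance {W} {T} seen z l cl f H =
      mono (+-mono-≤ u<W (+-mono-≤ u<W (+-monoˡ-≤ T (≤-trans (s≤s z≤n) u<W))))
        (scanˡ u (E _ _) (marked-skips seen)
          (rescanʳ {u = u} (find-unmarked z cl)
            (unchanged (cells-all (map (mark i) seen) (λ _ _ → E _ _)))
            (step (E _ _) H)))
      where
      u = marked seen
      u<W = length-marked seen f

    finish : ∀ {W T r b} seen l → All (Clear (suc i)) seen → length seen < W →
      Halts T (inj₁ ret) (map cell seen ++ D ∷ l , ♯ , r) b →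
      Halts (W + (W + (W + T))) (inj₁ (emb find)) (marked seen ++ D ∷ l , ♯ , r) b
    finish {W} {T} seen l cls f H =
      mono (+-mono-≤ u<W (+-mono-≤ u<W (+-monoˡ-≤ T (≤-trans (s≤s z≤n) u<W))))
        (scanˡ u (E _ _) (marked-skips seen)
          (rescanʳ {u = u} (E _ _) (marked-clears cls) (step (E _ _) H)))
      where
      u = marked seen
      u<W = length-marked seen f

  -- By induction on the code. The same `cs` stands before and after, since every loop removes its
  -- own marks; this is why an inner loop finds them clear again in the next round of the outer one.
  exec : ∀ {W T b n} c {emb ret} → Embeds c emb ret → length c ≤ d →
    ∀ cs → length cs ≡ n → All (Clear (length c)) cs → ∀ σ → Fits W n σ →
    After W n T ret cs b (iter (count c n) σ) →
    Halts (budget c W n T) (inj₁ (entry c emb ret)) (tape cs σ) b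
  exec []         E c≤d cs eq cls σ f after = after f
  exec {W} {T} {b} {n} (emit ∷ c) {emb} {ret} E c<d cs refl cls σ f after =
    transfer-halts c E cs σ f (go σ after)
    where
    go : ∀ σ → After W n T ret cs b (transfer σ >>= iter (count c n)) →
      After W n (budget c W n T) (entry c (emb ∘ inj₂) ret) cs b (transfer σ)
    go σ after with transfer σ
    ... | nothing = after
    ... | just σ' = λ f' →
      exec c (λ q a → E (inj₂ q) a) (<⇒≤ c<d) cs refl
        (All.map (λ cl j j<i → cl j (m≤n⇒m≤1+n j<i)) cls) σ' f' after
  exec {W} {T} {b} {n} (loop ∷ c) {emb} {ret} E c<d cs refl cls σ f after =
    go [] cs [] cls refl σ f after
    where
    open Loop E c<d
    bounded : ∀ seen {rest k} → length (seen ++ rest) ≡ n → n + k < W → length seen < W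
    bounded seen eq n+k<W =
      ≤-trans (s≤s (≤-trans (≤-trans (m≤m+n _ _) (≤-reflexive (≡-trans (sym (length-++ seen)) eq)))
        (m≤m+n n _))) n+k<W
    -- `seen` are the treated cells, nearest to ♯. They are marked on the tape, but the invariant
    -- keeps their unmarked form, to which the final clearing returns.
    go : ∀ seen rest → All (Clear (suc i)) seen → All (Clear (suc i)) rest →
      length (seen ++ rest) ≡ n → ∀ σ → Fits W n σ →
      After W n T ret (seen ++ rest) b (iter (length rest * count c n) σ) →
      Halts (rounds c W n (length rest) T) (inj₁ (emb find)) (tape (map (mark i) seen ++ rest) σ) b
    again : ∀ seen z rest → All (Clear (suc i)) (seen ∷ʳ z) → All (Clear (suc i)) rest →
      length ((seen ∷ʳ z) ++ rest) ≡ n → ∀ σ →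
      After W n T ret ((seen ∷ʳ z) ++ rest) b (iter (count c n + length rest * count c n) σ) →
      After W n (rounds c W n (length rest) T) (emb find) (map (mark i) (seen ∷ʳ z) ++ rest) b
        (iter (count c n) σ)
    again seen z rest cls cls' eq σ after
      -- Splits off the current round: it is one run of the body, and the remaining rounds are its
      -- continuation.
      rewrite iter-+ (count c n) (length rest * count c n) σ
      with iter (count c n) σ
    ... | nothing = after
    ... | just σ' = λ f' → go (seen ∷ʳ z) rest cls cls' eq σ' f' after
    go seen [] cls _ eq (j , ms , ys , raw) f after
      rewrite lead-++ (map (mark i) seen) [] j (weave ms) =
      finish seen _ cls (bounded seen eq (proj₁ f))
        (subst (λ l → Halts T (inj₁ ret) (l , ♯ , _) b) (lead-++ seen [] j (weave ms)) (after f))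
    go seen (z ∷ rest) cls (cl ∷ cls') eq σ@(j , ms , ys , raw) f after
      rewrite lead-++ (map (mark i) seen) (z ∷ rest) j (weave ms) =
      advance seen z _ cl (bounded seen eq (proj₁ f))
        (subst (λ l → Halts (budget c W n (rounds c W n (length rest) T)) _ (l , ♯ , _) b) shift
          (exec c (λ q a → E (inj₂ q) a) (<⇒≤ c<d) (map (mark i) (seen ∷ʳ z) ++ rest)
            length-eq
            (++⁺ (marks-clear cls₁) (All.map (λ cl j j<i → cl j (m≤n⇒m≤1+n j<i)) cls'))
            σ f
            (again seen z rest cls₁ cls' eq₁ σ
              (subst (λ cs → After W n T ret cs b (iter (count c n + length rest * count c n) σ))
                (sym (∷ʳ-++ seen z rest)) after))))
      where
      cls₁ : All (Clear (suc i)) (seen ∷ʳ z)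
      cls₁ = ++⁺ cls (cl ∷ [])
      eq₁ : length ((seen ∷ʳ z) ++ rest) ≡ n
      eq₁ = ≡-trans (cong length (∷ʳ-++ seen z rest)) eq
      length-eq : length (map (mark i) (seen ∷ʳ z) ++ rest) ≡ n
      length-eq = ≡-trans (length-++ (map (mark i) (seen ∷ʳ z)))
        (≡-trans (cong (_+ length rest) (length-map (mark i) (seen ∷ʳ z)))
          (≡-trans (sym (length-++ (seen ∷ʳ z))) eq₁))
      shift : lead (map (mark i) (seen ∷ʳ z) ++ rest) j ++ weave ms
        ≡ marked seen ++ cell (mark i z) ∷ lead rest j ++ weave ms
      shift = ≡-trans
        (cong (λ cs → lead cs j ++ weave ms)
          (≡-trans (cong (_++ rest) (map-++ (mark i) seen _))
            (∷ʳ-++ (map (mark i) seen) (mark i z) rest)))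
        (lead-++ (map (mark i) seen) (mark i z ∷ rest) j (weave ms))

-- After the transfers: checking the tag and simulating the machine for R

isYes-refl : ∀ {n} {q r : Fin n} → q ≡ r → isYes (q ≟ r) ≡ true
isYes-refl {q = q} {r} eq = ≡-trans (isYes≗does (q ≟ r)) (dec-true (q ≟ r) eq)

allFalse : Str → Bool
allFalse []          = true
allFalse (true ∷ z)  = false
allFalse (false ∷ z) = allFalse z

-- The rest of y' after y is a tag: 1 1 0* accepts always, 1 0 0* consults the flag, and 0 0* the
-- negation of R.
verdict : (Str → Bool) → List (Bool × Bool) → Str → Bool
verdict accepts ys []             = false
verdict accepts ys (true ∷ [])    = false
verdict accepts ys (true ∷ t ∷ z) = allFalse z ∧ (t ∨ isSet (foldl update first ys))
verdict accepts ys (false ∷ z)    = allFalse z ∧ not (accepts (map proj₁ ys))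

ʳ++-assoc : ∀ {A : Set} (xs : List A) {ys zs} → (xs ʳ++ ys) ++ zs ≡ xs ʳ++ (ys ++ zs)
ʳ++-assoc []       = refl
ʳ++-assoc (x ∷ xs) = ʳ++-assoc xs

All-ʳ++⁺ : ∀ {A : Set} {P : A → Set} {xs ys} → All P xs → All P ys → All P (xs ʳ++ ys)
All-ʳ++⁺ []       qs = qs
All-ʳ++⁺ (p ∷ ps) qs = All-ʳ++⁺ ps (p ∷ qs)

module Phases (R : PTimePred) (c₀ : Code) where

  open PTimePred R using (M; bound) renaming (halts to M-halts)
  open Run M c₀ public

  infix 4 _≈_

  -- What the simulated machine sees; beyond the end of its own tape the real one may hold junk that
  -- reads as blank.
  data _≈_ : List (Sym M.alph) → List Symbol → Set where
    pad : ∀ {l'} → All (λ a → view a ≡ blank) l' → [] ≈ l'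
    _∷_ : ∀ {s a l l'} → s ≡ view a → l ≈ l' → s ∷ l ≈ a ∷ l'

  Match : Tape M.alph → ATape → Set
  Match (l , h , r) (l' , h' , r') = l ≈ l' × h ≡ view h' × r ≈ r'

  match-move : ∀ m {t t'} → Match t t' → Match (moveT m t) (moveA m t')
  match-move left  (pad []       , h , r)            = pad [] , refl , h ∷ r
  match-move left  (pad (e ∷ es) , h , r)            = pad es , sym e , h ∷ r
  match-move left  (e ∷ l        , h , r)            = l , e , h ∷ r
  match-move right (l            , h , pad [])       = h ∷ l , refl , pad []
  match-move right (l            , h , pad (e ∷ es)) = h ∷ l , sym e , pad es
  match-move right (l            , h , e ∷ r)        = h ∷ l , e , r
  match-move stay  match                             = match

  match-init : ∀ {l w w'} → All (λ a → view a ≡ blank) l → w ≈ w' → Match (initTape w) (at l w')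
  match-init es (pad [])        = pad es , refl , pad []
  match-init es (pad (e ∷ es')) = pad es , sym e , pad es'
  match-init es (e ∷ w)         = pad es , e , w

  isAcc isRej : Fin M.states → Bool
  isAcc q = isYes (q ≟ M.acc)
  isRej q = isYes (q ≟ M.rej)

  module _ {q : Fin M.states} where

    dstep-acc : ∀ t → isAcc q ≡ true → dstep M (q , t) ≡ (q , t)
    dstep-acc t eq rewrite eq = refl

    dstep-rej : ∀ t → isAcc q ≡ false → isRej q ≡ true → dstep M (q , t) ≡ (q , t)
    dstep-rej t eq eq' rewrite eq | eq' = refl

    dstep-live : ∀ t → isAcc q ≡ false → isRej q ≡ false →
      let (q' , s , m) = M.δ q (readT t) in dstep M (q , t) ≡ (q' , moveT m (writeT s t))
    dstep-live t eq eq' rewrite eq | eq' = refl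

    δ-acc : ∀ a → isAcc q ≡ true → δ (sim q) a ≡ (inj₂ false , a , stay)
    δ-acc a eq rewrite eq = refl

    δ-rej : ∀ a → isAcc q ≡ false → isRej q ≡ true → δ (sim q) a ≡ (inj₂ true , a , stay)
    δ-rej a eq eq' rewrite eq | eq' = refl

    δ-live : ∀ a → isAcc q ≡ false → isRej q ≡ false → δ (sim q) a ≡ continue (M.δ q (view a))
    δ-live a eq eq' rewrite eq | eq' = refl

  drun-fixed : ∀ n {c} → dstep M c ≡ c → drun M n c ≡ c
  drun-fixed zero    eq = refl
  drun-fixed (suc n) eq rewrite eq = drun-fixed n eq

  -- The two machines move in lockstep; the extra step turns a halting state of M into the negated
  -- answer.
  simulates : ∀ n q t {t'} → Match t t' →
    let final = proj₁ (drun M n (q , t)) in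
    (final ≡ M.acc) ⊎ (final ≡ M.rej) →
    Halts (suc n) (inj₁ (sim q)) t' (not (isYes (final ≟ M.acc)))
  simulates n q t {t'} match h = go n match h (isAcc q) refl (isRej q) refl
    where
    answer-of : ℕ → Bool
    answer-of n = not (isYes (proj₁ (drun M n (q , t)) ≟ M.acc))
    fixed : ∀ n {v} → isAcc q ≡ v → dstep M (q , t) ≡ (q , t) → not v ≡ answer-of n
    fixed n eq same =
      cong not (≡-trans (sym eq) (cong (λ c → isYes (proj₁ c ≟ M.acc)) (sym (drun-fixed n same))))
    go : ∀ n {t'} → Match t t' →
      (proj₁ (drun M n (q , t)) ≡ M.acc) ⊎ (proj₁ (drun M n (q , t)) ≡ M.rej) →
      ∀ v → isAcc q ≡ v → ∀ v' → isRej q ≡ v' →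
      Halts (suc n) (inj₁ (sim q)) t' (answer-of n)
    go n {t'} match h true eq v' eq' =
      subst (Halts (suc n) (inj₁ (sim q)) t') (fixed n eq (dstep-acc t eq))
        (mono (s≤s z≤n) (step (δ-acc _ eq) (halted false)))
    go n {t'} match h false eq true eq' =
      subst (Halts (suc n) (inj₁ (sim q)) t') (fixed n eq (dstep-rej t eq eq'))
        (mono (s≤s z≤n) (step (δ-rej _ eq eq') (halted true)))
    -- Time is up, and the promise that M has halted contradicts the two failed tests.
    go zero match (inj₁ h) false eq false eq' = case ≡-trans (sym eq) (isYes-refl h) of λ ()
    go zero match (inj₂ h) false eq false eq' = case ≡-trans (sym eq') (isYes-refl h) of λ ()
    go (suc n) {l' , a , r'} (l≈ , h≡ , r≈) h false eq false eq' =
      step (δ-live a eq eq')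
        (subst (Halts (suc n) (inj₁ (sim q')) _)
          (cong (λ c → not (isYes (proj₁ (drun M n c) ≟ M.acc))) (sym live))
          (simulates n q' (moveT m (writeT s t)) (match-move m (l≈ , refl , r≈))
            (subst (λ c → (proj₁ (drun M n c) ≡ M.acc) ⊎ (proj₁ (drun M n c) ≡ M.rej)) live h)))
      where
      q' = proj₁ (M.δ q (view a))
      s  = proj₁ (proj₂ (M.δ q (view a)))
      m  = proj₂ (proj₂ (M.δ q (view a)))
      live : dstep M (q , t) ≡ (q' , moveT m (writeT s t))
      live = ≡-trans (dstep-live t eq eq')
        (cong (λ e → let (q' , s , m) = M.δ q e in q' , moveT m (writeT s t)) h≡)

  fresh : Bool → Cell
  fresh b = b , noMarks

  zeros-answer : ∀ v z {l} →
    Halts (suc (length z)) (inj₁ (zeros (answer v))) (at l (map bit z)) (allFalse z ∧ v)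
  zeros-answer v []          = step refl (halted v)
  zeros-answer v (true ∷ z)  = mono (s≤s z≤n) (step refl (halted false))
  zeros-answer v (false ∷ z) = step refl (zeros-answer v z)

  zeros-simulate : ∀ z {T l b} →
    Halts T (inj₁ rewind) (moveA left (replicate (length z) blk ++ l , blk , [])) b →
    Halts (suc (length z) + T) (inj₁ (zeros simulate)) (at l (map bit z)) (allFalse z ∧ b)
  zeros-simulate []          H = step refl H
  zeros-simulate (true ∷ z)  H = mono (s≤s z≤n) (step refl (halted false))
  zeros-simulate (false ∷ z) {T} {l} {b} H =
    step refl (zeros-simulate z (subst (λ l → Halts T (inj₁ rewind) (moveA left (l , blk , [])) b)
      (sym (replicate-shift (length z) blk l)) H))

  check-pairs : ∀ ys {T f l r b} →
    Halts T (inj₁ (check (foldl update f ys))) (at (map pair ys ʳ++ l) r) b →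
    Halts (length ys + T) (inj₁ (check f)) (at l (map pair ys ++ r)) b
  check-pairs []       H = H
  check-pairs (y ∷ ys) H = step refl (check-pairs ys H)

  weave-match : ∀ ms → All (λ a → view a ≡ blank) (weave ms)
  weave-match []       = []
  weave-match (b ∷ ms) = refl ∷ refl ∷ weave-match ms

  input-match : ∀ x ys {bl} → All (λ a → view a ≡ blank) bl →
    encPair x (map proj₁ ys) ≈ map (cell ∘ fresh) x ++ ♯ ∷ map pair ys ++ bl
  input-match []      ys {bl} es = refl ∷ go ys
    where
    go : ∀ ys → enc (map proj₁ ys) ≈ map pair ys ++ bl
    go []       = pad es
    go (y ∷ ys) = refl ∷ go ys
  input-match (b ∷ x) ys es = refl ∷ input-match x ys es

  fresh-ʳ++ : ∀ x r → map cell (map fresh (reverse x)) ʳ++ r ≡ map (cell ∘ fresh) x ++ r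
  fresh-ʳ++ x r = begin
    map cell (map fresh (reverse x)) ʳ++ r       ≡⟨ cong (_ʳ++ r) (map-∘ (reverse x)) ⟨
    map (cell ∘ fresh) (reverse x) ʳ++ r         ≡⟨ cong (_ʳ++ r) (map-ʳ++ (cell ∘ fresh) x) ⟩
    (map (cell ∘ fresh) x ʳ++ []) ʳ++ r          ≡⟨ ʳ++-ʳ++ (map (cell ∘ fresh) x) ⟩
    map (cell ∘ fresh) x ++ r                    ∎
    where open ≡-Reasoning

  -- The 2 covers the step off D onto the simulated input and the step that turns the halting state
  -- into an answer.
  simTime : ℕ → ℕ
  simTime n = 2 + eval bound n

  rewinds : ∀ x j ms ys k →
    let cs = map fresh (reverse x) in
    Halts (suc (k + (length ys + suc (length x))) + simTime (length x + suc (length ys))) (inj₁ rewind)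
      (moveA left (replicate k blk ++ blk ∷ (map pair ys ʳ++ (♯ ∷ lead cs j ++ weave ms)) , blk , []))
      (not (decideR R x (map proj₁ ys)))
  rewinds x j ms ys k =
    subst (λ l → Halts _ (inj₁ rewind) (moveA left (l , blk , [])) b) left-eq
      (subst (λ n → Halts (suc n + simTime _) (inj₁ rewind) (u ++ D ∷ l , blk , blk ∷ []) b) length-u
        (scanˡ u refl skips (step refl simulation)))
    where
    cs = map fresh (reverse x)
    b = not (decideR R x (map proj₁ ys))
    l = replicate j D ++ weave ms
    w = encPair x (map proj₁ ys)
    u = replicate k blk ++ (map pair ys ʳ++ (♯ ∷ map cell cs))
    length-w : length w ≡ length x + suc (length ys)
    length-w = ≡-trans (length-++ (enc x))
      (cong₂ _+_ (length-map bitSym x)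
        (cong suc (≡-trans (length-map bitSym (map proj₁ ys)) (length-map proj₁ ys))))
    left-eq : blk ∷ u ++ D ∷ l ≡
      replicate k blk ++ blk ∷ (map pair ys ʳ++ (♯ ∷ lead cs j ++ weave ms))
    left-eq = begin
      blk ∷ u ++ D ∷ l
        ≡⟨ cong (blk ∷_) (++-assoc (replicate k blk) _ _) ⟩
      blk ∷ replicate k blk ++ (map pair ys ʳ++ (♯ ∷ map cell cs)) ++ D ∷ l
        ≡⟨ cong (λ e → blk ∷ replicate k blk ++ e) (ʳ++-assoc (map pair ys)) ⟩
      blk ∷ replicate k blk ++ (map pair ys ʳ++ (♯ ∷ map cell cs ++ D ∷ l))
        ≡⟨ cong (λ e → blk ∷ replicate k blk ++ (map pair ys ʳ++ (♯ ∷ e)))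
             (++-assoc (map cell cs) _ _) ⟨
      blk ∷ replicate k blk ++ (map pair ys ʳ++ (♯ ∷ lead cs j ++ weave ms))
        ≡⟨ replicate-shift k blk _ ⟨
      replicate k blk ++ blk ∷ (map pair ys ʳ++ (♯ ∷ lead cs j ++ weave ms)) ∎
      where open ≡-Reasoning
    length-u : length u ≡ k + (length ys + suc (length x))
    length-u = ≡-trans (length-++ (replicate k blk))
      (cong₂ _+_ (length-replicate k)
        (≡-trans (length-ʳ++ (map pair ys))
          (cong₂ _+_ (length-map pair ys)
            (cong suc (≡-trans (length-map cell cs)
              (≡-trans (length-map fresh (reverse x)) (length-reverse x)))))))
    skips : All (Skips rewind left) u
    skips = ++⁺ (replicate⁺ k refl)
      (All-ʳ++⁺ (pairs-all ys (λ _ _ → refl)) (refl ∷ cells-all cs (λ _ _ → refl)))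
    bl = replicate k blk ʳ++ (blk ∷ blk ∷ [])
    right-eq : u ʳ++ (blk ∷ blk ∷ []) ≡ map (cell ∘ fresh) x ++ ♯ ∷ map pair ys ++ bl
    right-eq = begin
      u ʳ++ (blk ∷ blk ∷ [])
        ≡⟨ ++-ʳ++ (replicate k blk) ⟩
      (map pair ys ʳ++ (♯ ∷ map cell cs)) ʳ++ bl
        ≡⟨ ʳ++-ʳ++ (map pair ys) ⟩
      map cell cs ʳ++ (♯ ∷ map pair ys ++ bl)
        ≡⟨ fresh-ʳ++ x _ ⟩
      map (cell ∘ fresh) x ++ ♯ ∷ map pair ys ++ bl ∎
      where open ≡-Reasoning
    simulation : Halts (suc (eval bound (length x + suc (length ys)))) (inj₁ (sim M.start))
      (at (D ∷ l) (u ʳ++ (blk ∷ blk ∷ []))) b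
    simulation =
      subst (λ r → Halts _ (inj₁ (sim M.start)) (at (D ∷ l) r) b) (sym right-eq)
        (subst (λ n → Halts (suc (eval bound n)) (inj₁ (sim M.start))
            (at (D ∷ l) (map (cell ∘ fresh) x ++ ♯ ∷ map pair ys ++ bl)) b) length-w
          (simulates (eval bound (length w)) M.start (initTape w)
            (match-init (refl ∷ ++⁺ (replicate⁺ j refl) (weave-match ms))
              (input-match x ys (All-ʳ++⁺ (replicate⁺ k refl) (refl ∷ refl ∷ []))))
            (M-halts x (map proj₁ ys))))

-- Polynomial time bounds and the verifier as a predicate

infixl 6 _⊕_

_⊕_ : Poly → Poly → Poly
[]      ⊕ q       = q
(a ∷ p) ⊕ []      = a ∷ p
(a ∷ p) ⊕ (b ∷ q) = (a + b) ∷ (p ⊕ q)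

eval-⊕ : ∀ p q n → eval (p ⊕ q) n ≡ eval p n + eval q n
eval-⊕ []      q       n = refl
eval-⊕ (a ∷ p) []      n = sym (+-identityʳ _)
eval-⊕ (a ∷ p) (b ∷ q) n rewrite eval-⊕ p q n = rearrange a b n (eval p n) (eval q n)
  where
  rearrange : ∀ a b n u v → a + b + n * (u + v) ≡ a + n * u + (b + n * v)
  rearrange = solve-∀

eval-mono : ∀ p {m n} → m ≤ n → eval p m ≤ eval p n
eval-mono []      m≤n = z≤n
eval-mono (a ∷ p) m≤n = +-monoʳ-≤ a (*-mono-≤ m≤n (eval-mono p m≤n))

-- Five sweeps for an `emit`; for a loop, at most W rounds of three sweeps and the body, then three
-- more sweeps for clearing.
costs : Code → Poly
costs []         = []
costs (emit ∷ c) = (0 ∷ 5 ∷ []) ⊕ costs c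
costs (loop ∷ c) = (0 ∷ ((0 ∷ 3 ∷ []) ⊕ costs c)) ⊕ (0 ∷ 3 ∷ [])

budget-≤ : ∀ c {W n} T → n ≤ W → budget c W n T ≤ eval (costs c) W + T
rounds-≤ : ∀ c {W n} k T → n ≤ W →
  rounds c W n k T ≤ k * (3 * W + eval (costs c) W) + 3 * W + T
budget-≤ []         T n≤W = ≤-refl
budget-≤ (emit ∷ c) {W} {n} T n≤W
  rewrite eval-⊕ (0 ∷ 5 ∷ []) (costs c) W = begin
  W + (W + (W + (W + (W + budget c W n T))))
    ≤⟨ +-monoʳ-≤ W (+-monoʳ-≤ W (+-monoʳ-≤ W (+-monoʳ-≤ W (+-monoʳ-≤ W (budget-≤ c T n≤W))))) ⟩
  W + (W + (W + (W + (W + (eval (costs c) W + T)))))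
    ≡⟨ rearrange W (eval (costs c) W) T ⟩
  W * (5 + W * 0) + eval (costs c) W + T ∎
  where
  open ≤-Reasoning
  rearrange : ∀ W e T → W + (W + (W + (W + (W + (e + T))))) ≡ W * (5 + W * 0) + e + T
  rearrange = solve-∀
budget-≤ (loop ∷ c) {W} {n} T n≤W
  rewrite eval-⊕ (0 ∷ ((0 ∷ 3 ∷ []) ⊕ costs c)) (0 ∷ 3 ∷ []) W | eval-⊕ (0 ∷ 3 ∷ []) (costs c) W = begin
  rounds c W n n T
    ≤⟨ rounds-≤ c n T n≤W ⟩
  n * (3 * W + eval (costs c) W) + 3 * W + T
    ≤⟨ +-monoˡ-≤ T (+-monoˡ-≤ (3 * W) (*-monoˡ-≤ _ n≤W)) ⟩
  W * (3 * W + eval (costs c) W) + 3 * W + T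
    ≡⟨ rearrange W (eval (costs c) W) T ⟩
  W * (W * (3 + W * 0) + eval (costs c) W) + W * (3 + W * 0) + T ∎
  where
  open ≤-Reasoning
  rearrange : ∀ W e T → W * (3 * W + e) + 3 * W + T ≡ W * (W * (3 + W * 0) + e) + W * (3 + W * 0) + T
  rearrange = solve-∀
rounds-≤ c {W} zero T n≤W = ≤-reflexive (rearrange W T)
  where
  rearrange : ∀ W T → W + (W + (W + T)) ≡ 3 * W + T
  rearrange = solve-∀
rounds-≤ c {W} {n} (suc k) T n≤W = begin
  W + (W + (W + budget c W n (rounds c W n k T)))
    ≤⟨ +-monoʳ-≤ W (+-monoʳ-≤ W (+-monoʳ-≤ W (≤-trans (budget-≤ c _ n≤W)
         (+-monoʳ-≤ _ (rounds-≤ c k T n≤W))))) ⟩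
  W + (W + (W + (eval (costs c) W + (k * (3 * W + eval (costs c) W) + 3 * W + T))))
    ≡⟨ rearrange W (eval (costs c) W) (k * (3 * W + eval (costs c) W)) T ⟩
  (3 * W + eval (costs c) W) + k * (3 * W + eval (costs c) W) + 3 * W + T ∎
  where
  open ≤-Reasoning
  rearrange : ∀ W e r T → W + (W + (W + (e + (r + 3 * W + T)))) ≡ 3 * W + e + r + 3 * W + T
  rearrange = solve-∀

-- The bits come out reversed: the one guessed last is nearest to x and is used first.
parse : List Bool → Str → Maybe (List Bool × Str)
parse acc (true ∷ b ∷ w) = parse (b ∷ acc) w
parse acc (true ∷ [])    = nothing
parse acc (false ∷ x)    = just (acc , x)
parse acc []             = nothing

swap-ends : ∀ a b c → 1 + (a + (b + (1 + c))) ≡ 1 + (c + (b + (1 + a)))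
swap-ends = solve-∀

shift-two : ∀ a b → a + suc (suc b) ≡ suc (suc a) + b
shift-two = solve-∀

regroup : ∀ a b c → c + suc b + a ≡ c + (b + suc a)
regroup = solve-∀

module Decide (R : PTimePred) (c₀ : Code) where

  open PTimePred R using (bound)
  open Phases R c₀ public

  judge : Str → Maybe Stock → Bool
  judge x nothing                     = false
  judge x (just (j , ms , ys , raw)) = verdict (decideR R x) ys raw

  -- Specification of the whole verifier: after `decides` the machine can be forgotten and only this
  -- function is counted.
  outcome : Str → Maybe (List Bool × Str) → Bool
  outcome y nothing         = false
  outcome y (just (ms , x)) = judge x (iter (count c₀ (length x)) (0 , ms , [] , y))

  lastTime : ℕ → ℕ
  lastTime W = W + (W + (W + simTime W))

  check-halts : ∀ {W} x j ms ys raw → Fits W (length x) (j , ms , ys , raw) →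
    Halts (lastTime W) (inj₁ (check first)) (tape (map fresh (reverse x)) (j , ms , ys , raw))
      (verdict (decideR R x) ys raw)
  check-halts {W} x j ms ys raw (_ , f) =
    mono (+-mono-≤ ys<W (rest-≤ raw f)) (step refl (check-pairs ys (rest raw)))
    where
    l = map pair ys ʳ++ (♯ ∷ lead (map fresh (reverse x)) j ++ weave ms)
    g : length ys + length raw < W
    g = ≤-trans (s≤s (m≤n+m _ (length x))) f
    ys<W : length ys < W
    ys<W = ≤-trans (s≤s (m≤m+n _ (length raw))) g
    time : Str → ℕ
    time []             = 1
    time (true ∷ [])    = 2
    time (true ∷ t ∷ z) = 3 + length z
    time (false ∷ z)    = suc (suc (length z) +
      (suc (length z + (length ys + suc (length x))) + simTime (length x + suc (length ys))))
    rest-≤ : ∀ raw → length x + (length ys + length raw) < W → time raw ≤ W + (W + simTime W)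
    rest-≤ []             f = ≤-trans (≤-trans (s≤s z≤n) f) (m≤m+n W _)
    rest-≤ (true ∷ [])    f =
      +-mono-≤ (≤-trans (s≤s z≤n) f) (≤-trans (≤-trans (s≤s z≤n) f) (m≤m+n W _))
    rest-≤ (true ∷ t ∷ z) f =
      ≤-trans (≤-trans (s≤s (≤-trans (m≤n+m _ (length ys)) (m≤n+m _ (length x)))) f) (m≤m+n W _)
    rest-≤ (false ∷ z)    f =
      +-mono-≤ (≤-trans (s≤s (≤-trans (m≤n+m _ (length ys)) (m≤n+m _ (length x)))) f)
        (+-mono-≤ (≤-trans (≤-reflexive (swap-ends (length z) (length ys) (length x))) f)
          (+-monoʳ-≤ 2 (eval-mono bound
            (≤-trans (≤-trans (m≤m+n _ (length z))
              (≤-reflexive (regroup (length z) (length ys) (length x)))) (<⇒≤ f)))))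
    rest : ∀ raw → Halts (time raw) (inj₁ (check (foldl update first ys))) (at l (map bit raw))
      (verdict (decideR R x) ys raw)
    rest []                 = step refl (halted false)
    rest (true ∷ [])        = step refl (step refl (halted false))
    rest (true ∷ true ∷ z)  = step refl (step refl (zeros-answer true z))
    rest (true ∷ false ∷ z) = step refl (step refl (zeros-answer _ z))
    rest (false ∷ z)        = step refl (zeros-simulate z (rewinds x j ms ys (length z)))

  convert-halts : ∀ x acc {T l r b} →
    Halts T (inj₁ (entry c₀ (λ q → running q) (check first)))
      (map cell (map fresh (x ʳ++ acc)) ++ l , ♯ , r) b →
    Halts (length x + suc T) (inj₁ convert) (at (map cell (map fresh acc) ++ l) (map bit x ++ ♯ ∷ r)) b
  convert-halts []          acc H = step refl H
  convert-halts (true ∷ x)  acc H = step refl (convert-halts x (true ∷ acc) H)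
  convert-halts (false ∷ x) acc H = step refl (convert-halts x (false ∷ acc) H)

  mainTime : ℕ → ℕ
  mainTime W = eval (costs c₀) W + lastTime W

  run-halts : ∀ {W} x ms y → Fits W (length x) (0 , ms , [] , y) →
    Halts (mainTime W) (inj₁ (entry c₀ (λ q → running q) (check first)))
      (tape (map fresh (reverse x)) (0 , ms , [] , y)) (outcome y (just (ms , x)))
  run-halts {W} x ms y f =
    mono (budget-≤ c₀ _ (≤-trans (m≤m+n _ _) (<⇒≤ (proj₁ f))))
      (exec c₀ (λ _ _ → refl) ≤-refl cs length-cs
        (map⁺ (All.universal (λ _ j _ → get-noMarks d j) (reverse x))) (0 , ms , [] , y) f after)
    where
    cs = map fresh (reverse x)
    length-cs : length cs ≡ length x
    length-cs = ≡-trans (length-map fresh (reverse x)) (length-reverse x)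
    after : After W (length x) (lastTime W) (check first) cs
      (judge x (iter (count c₀ (length x)) (0 , ms , [] , y)))
      (iter (count c₀ (length x)) (0 , ms , [] , y))
    after with iter (count c₀ (length x)) (0 , ms , [] , y)
    ... | nothing                    = refl
    ... | just (j , ms' , ys , raw) = check-halts x j ms' ys raw

  -- The two symbols read for a guessed bit become `K b` and D, so the premise survives the
  -- recursion.
  parse-halts : ∀ {W} acc w y → length (weave acc) + (length w + suc (length y)) ≤ W →
    Halts (suc (length w) + mainTime W) (inj₁ parse₀) (at (weave acc) (map bit w ++ ♯ ∷ map bit y))
      (outcome y (parse acc w))
  parse-halts acc []                 y f = mono (s≤s z≤n) (step refl (halted false))
  parse-halts acc (true ∷ [])        y f =
    mono (s≤s (s≤s z≤n)) (step refl (step refl (halted false)))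
  parse-halts {W} acc (true ∷ true ∷ w) y f =
    step refl (step refl (parse-halts (true ∷ acc) w y
      (subst (_≤ W) (shift-two (length (weave acc)) _) f)))
  parse-halts {W} acc (true ∷ false ∷ w) y f =
    step refl (step refl (parse-halts (false ∷ acc) w y
      (subst (_≤ W) (shift-two (length (weave acc)) _) f)))
  parse-halts {W} acc (false ∷ x) y f =
    mono (≤-reflexive (cong suc (+-suc (length x) (mainTime W))))
      (step refl (convert-halts x []
        (subst (λ l → Halts (mainTime W) _ (l , ♯ , map bit y) (outcome y (just (acc , x))))
          (++-assoc (map cell (map fresh (reverse x))) _ _)
          (run-halts x acc y
            ( ≤-trans (≤-trans (m≤m+n _ (length y)) (≤-reflexive (shuffle n m (length y)))) f
            , ≤-trans (≤-trans (m≤m+n _ (suc m)) (≤-reflexive (shuffle′ n m (length y)))) f)))))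
    where
    n = length x
    m = length (weave acc)
    shuffle : ∀ n m y → suc (n + suc m) + y ≡ m + (suc n + suc y)
    shuffle = solve-∀
    shuffle′ : ∀ n m y → suc (n + y) + suc m ≡ m + (suc n + suc y)
    shuffle′ = solve-∀

  totalTime : Poly
  totalTime = (0 ∷ 1 ∷ []) ⊕ (costs c₀ ⊕ ((2 ∷ 3 ∷ []) ⊕ bound))

  totalTime-≥ : ∀ W m → m ≤ W → m + mainTime W ≤ eval totalTime W
  totalTime-≥ W m m≤W
    rewrite eval-⊕ (0 ∷ 1 ∷ []) (costs c₀ ⊕ ((2 ∷ 3 ∷ []) ⊕ bound)) W
          | eval-⊕ (costs c₀) ((2 ∷ 3 ∷ []) ⊕ bound) W
          | eval-⊕ (2 ∷ 3 ∷ []) bound W =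
    ≤-trans (+-monoˡ-≤ (mainTime W) m≤W)
      (≤-reflexive (rearrange W (eval (costs c₀) W) (eval bound W)))
    where
    rearrange : ∀ W e f → W + (e + (W + (W + (W + (2 + f)))))
      ≡ W * (1 + W * 0) + (e + ((2 + W * (3 + W * 0)) + f))
    rearrange = solve-∀

  encA-bits : ∀ w → map encA (map bit w) ≡ enc w
  encA-bits []          = refl
  encA-bits (true ∷ w)  = cong (_ ∷_) (encA-bits w)
  encA-bits (false ∷ w) = cong (_ ∷_) (encA-bits w)

  result : ∀ x y → let w = encPair x y in
    proj₁ (drun machine (eval totalTime (length w)) (dinit machine w)) ≡
      encS (inj₂ (outcome y (parse [] x)))
  result x y =
    subst
      (λ w → proj₁ (drun machine (eval totalTime (length w)) (dinit machine w)) ≡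
               encS (inj₂ (outcome y (parse [] x))))
      input-enc
      (≡-trans
        (cong (λ t → proj₁ (drun machine (eval totalTime W) (encS (inj₁ parse₀) , t)))
          (initTape-encA input))
        (at-start (parse-halts {W} [] x y (≤-reflexive (sym size)))))
    where
    input : List Symbol
    input = map bit x ++ ♯ ∷ map bit y
    input-enc : map encA input ≡ encPair x y
    input-enc = ≡-trans (map-++ encA (map bit x) _)
      (cong₂ (λ u v → u ++ sepSym ∷ v) (encA-bits x) (encA-bits y))
    W = length (map encA input)
    size : length (map encA input) ≡ length x + suc (length y)
    size = ≡-trans (length-map encA input)
      (≡-trans (length-++ (map bit x)) (cong₂ _+_ (length-map bit x) (cong suc (length-map bit y))))
    at-start : ∀ {t b} → Halts (suc (length x) + mainTime W) (inj₁ parse₀) t b →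
      proj₁ (drun machine (eval totalTime W) (encS (inj₁ parse₀) , encT t)) ≡ encS (inj₂ b)
    at-start (halts H) = H _ (totalTime-≥ W (suc (length x))
      (≤-trans (≤-trans (m≤m+n _ (length y)) (≤-reflexive (sym (+-suc (length x) (length y)))))
        (≤-reflexive (sym size))))

  predicate : PTimePred
  predicate = record
    { M     = machine
    ; bound = totalTime
    ; halts = λ x y → halting (result x y)
    }
    where
    halting : ∀ {q b} → q ≡ encS (inj₂ b) → (q ≡ zero) ⊎ (q ≡ suc zero)
    halting {b = true}  eq = inj₁ eq
    halting {b = false} eq = inj₂ eq

  decides : ∀ x y → decideR predicate x y ≡ outcome y (parse [] x)
  decides x y = ≡-trans (cong (λ q → isYes (q ≟ zero)) (result x y)) (answers (outcome y (parse [] x)))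
    where
    answers : ∀ b → isYes (encS (inj₂ b) ≟ zero) ≡ b
    answers true  = refl
    answers false = refl

-- Counting the witnesses

indicator : Bool → ℕ
indicator b = if b then 1 else 0

sumOver : ℕ → (Str → ℕ) → ℕ
sumOver zero    f = f []
sumOver (suc n) f = sumOver n (f ∘ (false ∷_)) + sumOver n (f ∘ (true ∷_))

sum-allStrings : ∀ n f → sum (map f (allStrings n)) ≡ sumOver n f
sum-allStrings zero    f = +-identityʳ (f [])
sum-allStrings (suc n) f = begin
  sum (map f (map (false ∷_) S ++ map (true ∷_) S))
    ≡⟨ cong sum (map-++ f (map (false ∷_) S) (map (true ∷_) S)) ⟩
  sum (map f (map (false ∷_) S) ++ map f (map (true ∷_) S))
    ≡⟨ sum-++ (map f (map (false ∷_) S)) _ ⟩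
  sum (map f (map (false ∷_) S)) + sum (map f (map (true ∷_) S))
    ≡⟨ cong₂ (λ u v → sum u + sum v) (map-∘ S) (map-∘ S) ⟨
  sum (map (f ∘ (false ∷_)) S) + sum (map (f ∘ (true ∷_)) S)
    ≡⟨ cong₂ _+_ (sum-allStrings n (f ∘ (false ∷_))) (sum-allStrings n (f ∘ (true ∷_))) ⟩
  sumOver n (f ∘ (false ∷_)) + sumOver n (f ∘ (true ∷_)) ∎
  where
  open ≡-Reasoning
  S = allStrings n

sumOver-cong : ∀ n {f g} → (∀ y → length y ≡ n → f y ≡ g y) → sumOver n f ≡ sumOver n g
sumOver-cong zero    eq = eq [] refl
sumOver-cong (suc n) eq =
  cong₂ _+_ (sumOver-cong n λ y e → eq (false ∷ y) (cong suc e))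
            (sumOver-cong n λ y e → eq (true ∷ y) (cong suc e))

sumOver-+ : ∀ n f g → sumOver n (λ y → f y + g y) ≡ sumOver n f + sumOver n g
sumOver-+ zero    f g = refl
sumOver-+ (suc n) f g
  rewrite sumOver-+ n (f ∘ (false ∷_)) (g ∘ (false ∷_)) | sumOver-+ n (f ∘ (true ∷_)) (g ∘ (true ∷_)) =
  interchange (sumOver n (f ∘ (false ∷_))) _ _ _
  where
  interchange : ∀ a b c d → a + b + (c + d) ≡ a + c + (b + d)
  interchange = solve-∀

sumOver-split : ∀ m n f → sumOver (m + n) f ≡ sumOver m (λ y → sumOver n (λ z → f (y ++ z)))
sumOver-split zero    n f = refl
sumOver-split (suc m) n f =
  cong₂ _+_ (sumOver-split m n (f ∘ (false ∷_))) (sumOver-split m n (f ∘ (true ∷_)))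

sumOver-const : ∀ n v → sumOver n (λ _ → v) ≡ v * 2 ^ n
sumOver-const zero    v = sym (*-identityʳ v)
sumOver-const (suc n) v rewrite sumOver-const n v = double v (2 ^ n)
  where
  double : ∀ v e → v * e + v * e ≡ v * (e + (e + 0))
  double = solve-∀

sumOver-complement : ∀ n f →
  sumOver n (indicator ∘ f) + sumOver n (indicator ∘ not ∘ f) ≡ 2 ^ n
sumOver-complement n f = begin
  sumOver n (indicator ∘ f) + sumOver n (indicator ∘ not ∘ f)
    ≡⟨ sumOver-+ n _ _ ⟨
  sumOver n (λ y → indicator (f y) + indicator (not (f y)))
    ≡⟨ sumOver-cong n (λ y _ → one (f y)) ⟩
  sumOver n (λ _ → 1)
    ≡⟨ sumOver-const n 1 ⟩
  1 * 2 ^ n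
    ≡⟨ *-identityˡ (2 ^ n) ⟩
  2 ^ n ∎
  where
  open ≡-Reasoning
  one : ∀ b → indicator b + indicator (not b) ≡ 1
  one true  = refl
  one false = refl

sumOver-allFalse : ∀ n v → sumOver n (λ z → indicator (allFalse z ∧ v)) ≡ indicator v
sumOver-allFalse zero    v = refl
sumOver-allFalse (suc n) v =
  ≡-trans (cong₂ _+_ (sumOver-allFalse n v) (sumOver-const n 0)) (+-identityʳ _)

-- Each of the three tags forces the padding to be zeros and so leaves one tail: one for rejection
-- by R, one for the flag, one unconditional. Summed over y these yield N̄, m and 2ⁿ.
sumOver-verdict : ∀ k accepts ys →
  sumOver (2 + k) (indicator ∘ verdict accepts ys) ≡
  indicator (not (accepts (map proj₁ ys))) + (indicator (isSet (foldl update first ys)) + 1)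
sumOver-verdict k accepts ys
  rewrite sumOver-allFalse k (not (accepts (map proj₁ ys))) | sumOver-const k 0
        | sumOver-allFalse k (isSet (foldl update first ys)) | sumOver-allFalse k true
        | +-identityʳ (indicator (not (accepts (map proj₁ ys)))) = refl

-- Numbers spelled by the guessed bits, and powers of two

value : ℕ → List Bool → ℕ
value (suc n) (b ∷ ms) = value n ms + indicator b * 2 ^ n
value _       _        = 0

value-< : ∀ n ms → value n ms < 2 ^ n
value-< zero    ms           = s≤s z≤n
value-< (suc n) []           = m^n>0 2 (suc n)
value-< (suc n) (true ∷ ms)  = +-mono-≤ (value-< n ms) ≤-refl
value-< (suc n) (false ∷ ms) = +-mono-≤ (value-< n ms) z≤n

value-surjective : ∀ n v → v < 2 ^ n → ∃[ ms ] length ms ≡ n × value n ms ≡ v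
value-surjective zero    zero    _         = [] , refl , refl
value-surjective zero    (suc v) (s≤s ())
value-surjective (suc n) v       v<        with v <? 2 ^ n
... | yes v<2^n =
  let (ms , eq , eq') = value-surjective n v v<2^n
  in false ∷ ms , cong suc eq , ≡-trans (+-identityʳ _) eq'
... | no v≮2^n =
  let (u , u≡)        = m≤n⇒∃[o]m+o≡n (≮⇒≥ v≮2^n)
      u<              = +-cancelˡ-< (2 ^ n) u (2 ^ n)
                          (subst₂ _<_ (sym u≡) (cong (2 ^ n +_) (+-identityʳ (2 ^ n))) v<)
      (ms , eq , eq') = value-surjective n u u<
  in true ∷ ms , cong suc eq ,
     ≡-trans (cong₂ _+_ eq' (+-identityʳ (2 ^ n))) (≡-trans (+-comm u (2 ^ n)) u≡)

-- Counting positions from 0, exactly 2ⁿ⁻¹⁻ⁱ strings of length n have their first 1 at position i,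
-- which is the binary weight of bit i. Started at `unset`, the count is thus the number spelled by
-- the first n bits, obtained without any arithmetic on the tape.
flagged : Flag → ℕ → List Bool → ℕ
flagged f n ms = sumOver n (λ y → indicator (isSet (foldl update f (zip y ms))))

foldl-update-set : ∀ v ys → foldl update (set! v) ys ≡ set! v
foldl-update-set v []       = refl
foldl-update-set v (y ∷ ys) = foldl-update-set v ys

flagged-set : ∀ v n ms → flagged (set! v) n ms ≡ indicator v * 2 ^ n
flagged-set v n ms =
  ≡-trans (sumOver-cong n (λ y _ → cong (indicator ∘ isSet) (foldl-update-set v (zip y ms))))
    (sumOver-const n (indicator v))

flagged-unset : ∀ n ms → n ≤ length ms → flagged unset n ms ≡ value n ms
flagged-unset zero    ms       _         = refl
flagged-unset (suc n) (b ∷ ms) (s≤s n≤m) =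
  cong₂ _+_ (flagged-unset n ms n≤m) (flagged-set b n ms)

flagged-first : ∀ n b ms → n ≤ length ms → flagged first (suc n) (b ∷ ms) ≡ value n ms + 2 ^ n
flagged-first n b ms n≤m =
  cong₂ _+_ (flagged-unset n ms n≤m) (≡-trans (flagged-set true n ms) (*-identityˡ (2 ^ n)))

-- For positive n the leading bit read as 1 contributes 2ⁿ⁻¹. The bounds are put in terms of F + 1,
-- the candidate for N, and say that it would be a majority.
flagged-bounds : ∀ n ms → n ≤ length ms →
  suc (flagged first n ms) ≤ 2 ^ n × 2 ^ n < 2 * suc (flagged first n ms)
flagged-bounds zero    ms       _         = s≤s z≤n , s≤s (s≤s z≤n)
flagged-bounds (suc n) (b ∷ ms) (s≤s n≤m) rewrite flagged-first n b ms n≤m =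
  ≤-trans (+-monoˡ-≤ (2 ^ n) (value-< n ms)) (+-monoʳ-≤ (2 ^ n) (m≤m+n _ 0)) ,
  *-monoʳ-< 2 (s≤s (m≤n+m (2 ^ n) (value n ms)))

flagged-surjective : ∀ n k → k + k < 2 ^ n →
  ∃[ ms ] length ms ≡ n × suc (flagged first n ms) + k ≡ 2 ^ n
flagged-surjective zero    zero    _        = [] , refl , refl
flagged-surjective zero    (suc k) (s≤s ())
flagged-surjective (suc n) k       k<       =
  let k<2^n           = *-cancelˡ-< 2 k (2 ^ n)
                          (subst (_< 2 ^ suc n) (cong (k +_) (sym (+-identityʳ k))) k<)
      (v , v≡)        = m≤n⇒∃[o]m+o≡n k<2^n
      (ms , eq , eq') = value-surjective n v (subst (v <_) v≡ (s≤s (m≤n+m v k)))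
  -- The leading bit is arbitrary, since `first` reads it as 1; the others spell v = 2ⁿ - 1 - k.
  in false ∷ ms , cong suc eq ,
     ≡-trans (cong (λ e → suc e + k)
         (≡-trans (flagged-first n false ms (≤-reflexive (sym eq))) (cong (_+ 2 ^ n) eq')))
       (≡-trans (rearrange v k (2 ^ n)) (cong (λ e → e + (2 ^ n + 0)) v≡))
  where
  rearrange : ∀ v k e → 1 + (v + e) + k ≡ (1 + k) + v + (e + 0)
  rearrange = solve-∀

power-window : ∀ n t {s} → s ≡ 2 ^ suc t → 2 ^ n < s → s < 2 ^ (2 + n) → t ≡ n
power-window n t refl lo hi with <-cmp t n
... | tri≈ _ t≡n _ = t≡n
... | tri< t<n _ _ = contradiction lo (≤⇒≯ (^-monoʳ-≤ 2 t<n))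
... | tri> _ _ n<t = contradiction hi (≤⇒≯ (^-monoʳ-≤ 2 (s≤s n<t)))

majority⇒power : ∀ n N N̄ F → N + N̄ ≡ 2 ^ n → suc F + N̄ ≡ 2 ^ n →
  N̄ + (F + 2 ^ n) + 1 ≡ 2 ^ suc n
majority⇒power n N N̄ F _ eq =
  ≡-trans (rearrange N̄ F (2 ^ n)) (cong (λ e → e + (2 ^ n + 0)) eq)
  where
  rearrange : ∀ k f e → k + (f + e) + 1 ≡ 1 + f + k + (e + 0)
  rearrange = solve-∀

-- Since F + 1 and N̄ are at most 2ⁿ, the total is above 2ⁿ and at most 3 · 2ⁿ, which leaves only
-- the power 2ⁿ⁺¹. Cancelling forces N = F + 1, and F + 1 exceeds half of 2ⁿ.
power⇒majority : ∀ n t N N̄ F → N + N̄ ≡ 2 ^ n → suc F ≤ 2 ^ n → 2 ^ n < 2 * suc F →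
  N̄ + (F + 2 ^ n) + 1 ≡ 2 ^ suc t → 2 ^ n < 2 * N
power⇒majority n t N N̄ F total F≤ F> eq = subst (λ e → 2 ^ n < 2 * e) F≡N F>
  where
  e = 2 ^ n
  N̄≤ : N̄ ≤ e
  N̄≤ = subst (N̄ ≤_) total (m≤n+m N̄ N)
  rearrange₁ : ∀ e k f → 1 + e + (k + f) ≡ k + (f + e) + 1
  rearrange₁ = solve-∀
  rearrange₂ : ∀ e k f → k + (f + e) + 1 ≡ k + ((1 + f) + e)
  rearrange₂ = solve-∀
  lo : e < N̄ + (F + e) + 1
  lo = subst (e <_) (rearrange₁ e N̄ F) (m≤m+n (suc e) _)
  hi : N̄ + (F + e) + 1 < 2 ^ (2 + n)
  hi = begin-strict
    N̄ + (F + e) + 1         ≡⟨ rearrange₂ e N̄ F ⟩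
    N̄ + (suc F + e)         ≤⟨ +-mono-≤ N̄≤ (+-monoˡ-≤ e F≤) ⟩
    e + (e + e)             <⟨ +-monoʳ-< e (+-monoʳ-< e (m<m+n e (m^n>0 2 n))) ⟩
    e + (e + (e + e))       ≡⟨ fourfold e ⟩
    2 ^ (2 + n) ∎
    where
    open ≤-Reasoning
    fourfold : ∀ e → e + (e + (e + e)) ≡ 2 * (2 * e)
    fourfold = solve-∀
  sum≡ : e + (suc F + N̄) ≡ e + e
  sum≡ = begin
    e + (suc F + N̄)       ≡⟨ rearrange₅ e N̄ F ⟩
    N̄ + (F + e) + 1       ≡⟨ eq ⟩
    2 ^ suc t             ≡⟨ cong (λ t → 2 ^ suc t) (power-window n t eq lo hi) ⟩
    e + (e + 0)           ≡⟨ cong (e +_) (+-identityʳ e) ⟩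
    e + e ∎
    where
    open ≡-Reasoning
    rearrange₅ : ∀ e k f → e + ((1 + f) + k) ≡ k + (f + e) + 1
    rearrange₅ = solve-∀
  F≡N : suc F ≡ N
  F≡N = +-cancelʳ-≡ N̄ (suc F) N (≡-trans (+-cancelˡ-≡ e _ _ sum≡) (sym total))

minority : ∀ {e} N N̄ → N + N̄ ≡ e → e < 2 * N → N̄ + N̄ < e
minority {e} N N̄ total e<2N = subst (N̄ + N̄ <_) total (+-monoˡ-< N̄ N̄<N)
  where
  N̄<N : N̄ < N
  N̄<N = +-cancelˡ-< N N̄ N (subst₂ _<_ (sym total) (cong (N +_) (+-identityʳ N)) e<2N)

-- The oracle machine

pairs : List Bool → Str
pairs []       = []
pairs (b ∷ bs) = true ∷ b ∷ pairs bs

query : List Bool → Str → Str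
query bs x = pairs bs ++ false ∷ x

pairs-∷ʳ : ∀ bs b → pairs (bs ∷ʳ b) ≡ (pairs bs ++ [ true ]) ++ [ b ]
pairs-∷ʳ []        b = refl
pairs-∷ʳ (b' ∷ bs) b = cong (λ w → true ∷ b' ∷ w) (pairs-∷ʳ bs b)

parse-query : ∀ acc bs x → parse acc (query bs x) ≡ just (bs ʳ++ acc , x)
parse-query acc []       x = refl
parse-query acc (b ∷ bs) x = parse-query (b ∷ acc) bs x

length-query : ∀ bs x → length bs ≤ length (query bs x)
length-query []       x = z≤n
length-query (b ∷ bs) x = s≤s (≤-trans (length-query bs x) (n≤1+n _))

pattern guess  = zero
pattern guess′ = suc zero
pattern copy   = suc (suc zero)
pattern ask    = suc (suc (suc zero))
pattern yes!   = suc (suc (suc (suc zero)))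
pattern no!    = suc (suc (suc (suc (suc zero))))

-- The same machine serves every p and R: the number of guessed bits is free, and only the time
-- bound limits it.
guesser : ONTM
guesser = record
  { states = 6
  ; alph   = 0
  ; start  = guess
  ; acc    = yes!
  ; qry    = ask
  ; qyes   = yes!
  ; qno    = no!
  ; δ      = transitions
  }
  where
  transitions : Fin 6 → Sym 0 → List (Fin 6 × Sym 0 × Move × Maybe Bool)
  transitions guess  a                =
    (guess′ , a , stay , just true) ∷ (copy , a , stay , just false) ∷ []
  transitions guess′ a                =
    (guess , a , stay , just false) ∷ (guess , a , stay , just true) ∷ []
  transitions copy   (suc zero)       = (copy , suc zero , right , just false) ∷ []
  transitions copy   (suc (suc zero)) = (copy , suc (suc zero) , right , just true) ∷ []
  transitions copy   a                = (ask , a , stay , nothing) ∷ []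
  transitions _      a                = []

reading : List (Sym 0) → List (Sym 0) → Tape 0
reading l []      = l , blank , []
reading l (a ∷ r) = l , a , r

initTape-reading : ∀ w → initTape w ≡ reading [] w
initTape-reading []      = refl
initTape-reading (a ∷ w) = refl

moveT-reading : ∀ l a r → moveT right (l , a , r) ≡ reading (a ∷ l) r
moveT-reading l a []      = refl
moveT-reading l a (b ∷ r) = refl

module Guessing (O : Language) (x : Str) where

  init : Tape 0
  init = initTape (enc x)

  -- The invariant behind soundness: on every path the string asked has the form `query bs x`, so
  -- acceptance yields some bs with a positive answer.
  Reachable : OConf guesser O → Set
  Reachable (guess  , t , w) = ∃[ bs ] t ≡ init × w ≡ pairs bs
  Reachable (guess′ , t , w) = ∃[ bs ] t ≡ init × w ≡ pairs bs ++ [ true ]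
  Reachable (copy   , t , w) = ∃[ bs ] ∃[ u ] ∃[ v ] ∃[ l ]
    x ≡ u ++ v × t ≡ reading l (enc v) × w ≡ query bs u
  Reachable (ask    , t , w) = ∃[ bs ] w ≡ query bs x
  Reachable (yes!   , t , w) = ∃[ bs ] O (query bs x)
  Reachable (no!    , t , w) = ⊤

  copied : ∀ bs u b → query bs u ++ [ b ] ≡ query bs (u ∷ʳ b)
  copied bs u b = ++-assoc (pairs bs) (false ∷ u) [ b ]

  reachable-step : ∀ {c c'} → Reachable c → OStep guesser O c c' → Reachable c'
  reachable-step {guess , _} (bs , refl , refl) (trans _ (here refl)) = bs , refl , refl
  reachable-step {guess , _} (bs , refl , refl) (trans _ (there (here refl))) =
    bs , [] , x , [] , refl , initTape-reading (enc x) , refl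
  reachable-step {guess′ , _} (bs , refl , refl) (trans _ (here refl)) =
    bs ∷ʳ false , refl , sym (pairs-∷ʳ bs false)
  reachable-step {guess′ , _} (bs , refl , refl) (trans _ (there (here refl))) =
    bs ∷ʳ true , refl , sym (pairs-∷ʳ bs true)
  reachable-step {copy , _} (bs , u , [] , l , refl , refl , refl) (trans _ (here refl)) =
    bs , cong (query bs) (sym (++-identityʳ u))
  reachable-step {copy , _} (bs , u , false ∷ v , l , refl , refl , refl) (trans _ (here refl)) =
    bs , u ∷ʳ false , v , _ , sym (++-assoc u _ v) , moveT-reading l _ (enc v) , copied bs u false
  reachable-step {copy , _} (bs , u , true ∷ v , l , refl , refl , refl) (trans _ (here refl)) =
    bs , u ∷ʳ true , v , _ , sym (++-assoc u _ v) , moveT-reading l _ (enc v) , copied bs u true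
  reachable-step {ask , _} _           (trans ask≢ _) = contradiction refl ask≢
  reachable-step {ask , _} (bs , refl) (ansYes o)     = bs , o
  reachable-step {ask , _} _           (ansNo _)      = _
  reachable-step {yes! , _} _          (trans _ ())
  reachable-step {no! , _} _           (trans _ ())

  reachable-steps : ∀ {n c c'} → Reachable c → OSteps guesser O n c c' → Reachable c'
  reachable-steps r done        = r
  reachable-steps r (next s ss) = reachable-steps (reachable-step r s) ss

  accepts⇒query : ∀ {T} → AcceptsWithin guesser O T x → ∃[ bs ] O (query bs x)
  accepts⇒query (_ , (yes! , _) , _ , steps , refl) = reachable-steps ([] , refl , refl) steps

  Finishes : ℕ → OConf guesser O → Set
  Finishes n c = Σ (OConf guesser O) λ c' → OSteps guesser O n c c' × proj₁ c' ≡ yes!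

  then : ∀ {n c c'} → OStep guesser O c c' → Finishes n c' → Finishes (suc n) c
  then s (c' , ss , e) = c' , next s ss , e

  append : ∀ {q q' t w b} → q ≢ ask → (q' , readT t , stay , just b) ∈ ONTM.δ guesser q (readT t) →
    OStep guesser O (q , t , w) (q' , t , w ++ [ b ])
  append = trans

  copying : ∀ v bs u l → x ≡ u ++ v → O (query bs x) →
    Finishes (length v + 2) (copy , reading l (enc v) , query bs u)
  copying [] bs u l refl o =
    then (trans (λ ()) (here refl))
      (then (ansYes (subst (O ∘ query bs) (++-identityʳ u) o)) (_ , done , refl))
  copying (b ∷ v) bs u l refl o =
    then (move b)
      (subst₂ (λ t w → Finishes (length v + 2) (copy , t , w))
        (sym (moveT-reading l _ (enc v))) (sym (copied bs u b))
        (copying v bs (u ∷ʳ b) (bitSym b ∷ l) (sym (++-assoc u _ v)) o))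
    where
    move : ∀ b → OStep guesser O (copy , (l , bitSym b , enc v) , query bs u)
      (copy , moveT right (l , bitSym b , enc v) , query bs u ++ [ b ])
    move false = trans (λ ()) (here refl)
    move true  = trans (λ ()) (here refl)

  -- Two steps per guessed bit, one for the delimiter, one per symbol of x, then one to enter `ask`
  -- and one for the answer.
  guessing : ∀ rest bs → O (query (bs ++ rest) x) →
    Finishes (length rest + length rest + (1 + (length x + 2))) (guess , init , pairs bs)
  guessing [] bs o =
    then stop
      (subst (λ t → Finishes (length x + 2) (copy , t , query bs [])) (sym (initTape-reading (enc x)))
        (copying x bs [] [] refl (subst (λ bs → O (query bs x)) (++-identityʳ bs) o)))
    where
    stop : OStep guesser O (guess , init , pairs bs) (copy , init , query bs [])
    stop = append (λ ()) (there (here refl))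
  guessing (b ∷ rest) bs o =
    subst (λ n → Finishes n (guess , init , pairs bs))
      (cong (λ n → suc (n + (1 + (length x + 2)))) (sym (+-suc (length rest) (length rest))))
      (then more
        (then (choose b)
          (subst (λ w → Finishes _ (guess , init , w)) (pairs-∷ʳ bs b)
            (guessing rest (bs ∷ʳ b) (subst (λ bs → O (query bs x)) (sym (++-assoc bs _ rest)) o)))))
    where
    more : OStep guesser O (guess , init , pairs bs) (guess′ , init , pairs bs ++ [ true ])
    more = append (λ ()) (here refl)
    choose : ∀ b → OStep guesser O (guess′ , init , pairs bs ++ [ true ])
      (guess , init , (pairs bs ++ [ true ]) ++ [ b ])
    choose false = append (λ ()) (here refl)
    choose true  = append (λ ()) (there (here refl))

  query⇒accepts : ∀ {T} bs → O (query bs x) →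
    length bs + length bs + (3 + length x) ≤ T → AcceptsWithin guesser O T x
  query⇒accepts bs o bound =
    let (c , steps , e) = guessing bs [] o
    in _ , c ,
       ≤-trans (≤-reflexive (cong (λ n → length bs + length bs + suc n) (+-comm (length x) 2))) bound ,
       steps , e

-- The witness count of a query, and the reduction

iter-success : ∀ y {j ms ys q} → length y ≤ length ms →
  ∃[ j' ] ∃[ ms' ] iter (length y) (j , ms , ys , y ++ q) ≡ just (j' , ms' , ys ++ zip y ms , q)
iter-success []      {ys = ys} _ = _ , _ , cong (λ ys → just (_ , _ , ys , _)) (sym (++-identityʳ ys))
iter-success (c ∷ y) {j} {b ∷ ms} {ys} (s≤s y≤ms) =
  let (j' , ms' , eq) = iter-success y {2 + j} {ms} {ys ∷ʳ (c , b)} y≤ms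
  in j' , ms' , ≡-trans eq (cong (λ ys → just (j' , ms' , ys , _)) (++-assoc ys _ _))

iter-fail : ∀ k {j ms ys raw} → length ms < k → iter k (j , ms , ys , raw) ≡ nothing
iter-fail (suc k) {ms = []}                  _        = refl
iter-fail (suc k) {ms = b ∷ ms} {raw = []}    _        = refl
iter-fail (suc k) {ms = b ∷ ms} {raw = c ∷ _} (s≤s lt) = iter-fail k lt

map-proj₁-zip : ∀ (y : List Bool) (ms : List Bool) → length y ≤ length ms → map proj₁ (zip y ms) ≡ y
map-proj₁-zip []      ms       _          = refl
map-proj₁-zip (c ∷ y) (b ∷ ms) (s≤s y≤ms) = cong (c ∷_) (map-proj₁-zip y ms y≤ms)

module Reduction (p : Poly) (R : PTimePred) where

  open Decide R (code p) using (outcome; judge; predicate; decides)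

  paddedLength : Poly
  paddedLength = 2 ∷ 1 ∷ []

  oracle : Language
  oracle x = ∃[ t ] countN paddedLength predicate x + 1 ≡ 2 ^ suc t

  oracle∈MNS : MNS oracle
  oracle∈MNS = paddedLength , predicate , λ x → mk⇔ id id

  module _ (x : Str) where

    n = eval p (length x)

    accepted rejected : ℕ
    accepted = countN p R x
    rejected = sumOver n (indicator ∘ not ∘ decideR R x)

    accepted+rejected : accepted + rejected ≡ 2 ^ n
    accepted+rejected =
      ≡-trans (cong (_+ rejected) (sum-allStrings n (indicator ∘ decideR R x)))
        (sumOver-complement n (decideR R x))

    module _ (bs : List Bool) where

      ms : List Bool
      ms = reverse bs

      decides-query : ∀ y → decideR predicate (query bs x) y ≡ judge x (iter n (0 , ms , [] , y))
      decides-query y =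
        ≡-trans (decides (query bs x) y)
          (≡-trans (cong (outcome y) (parse-query [] bs x))
            (cong (λ k → judge x (iter k (0 , ms , [] , y))) (count-code p (length x))))

      count-query : countN paddedLength predicate (query bs x) ≡
        sumOver (2 + length (query bs x)) (λ y → indicator (judge x (iter n (0 , ms , [] , y))))
      count-query =
        ≡-trans (sum-allStrings (eval paddedLength L) _)
          (≡-trans (cong (λ k → sumOver k f) (length-eq L))
            (sumOver-cong (2 + L) (λ y _ → cong indicator (decides-query y))))
        where
        L = length (query bs x)
        f = indicator ∘ decideR predicate (query bs x)
        length-eq : ∀ L → 2 + L * (1 + L * 0) ≡ 2 + L
        length-eq = solve-∀

      count-short : length bs < n → countN paddedLength predicate (query bs x) ≡ 0
      count-short short =
        ≡-trans count-query
          (≡-trans (sumOver-cong (2 + length (query bs x)) (λ y _ → cong (indicator ∘ judge x)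
              (iter-fail n {0} {ms} {[]} {y} (subst (_< n) (sym (length-reverse bs)) short))))
            (sumOver-const (2 + length (query bs x)) 0))

      count-long : n ≤ length bs →
        countN paddedLength predicate (query bs x) ≡ rejected + (flagged first n ms + 2 ^ n)
      count-long n≤bs = begin
        countN paddedLength predicate (query bs x)
          ≡⟨ count-query ⟩
        sumOver (2 + length (query bs x)) g
          -- The query has length n + k, so y' is y followed by a tail of length 2 + k, which holds
          -- tag and padding.
          ≡⟨ cong (λ k → sumOver k g) (≡-trans (cong (2 +_) (sym L≡)) (regroup-two n k)) ⟩
        sumOver (n + (2 + k)) g
          ≡⟨ sumOver-split n (2 + k) g ⟩
        sumOver n (λ y → sumOver (2 + k) (λ q → g (y ++ q)))
          ≡⟨ sumOver-cong n inner ⟩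
        sumOver n (λ y → indicator (not (decideR R x y)) +
          (indicator (isSet (foldl update first (zip y ms))) + 1))
          ≡⟨ sumOver-+ n _ _ ⟩
        rejected + sumOver n (λ y → indicator (isSet (foldl update first (zip y ms))) + 1)
          ≡⟨ cong (rejected +_) (sumOver-+ n _ _) ⟩
        rejected + (flagged first n ms + sumOver n (λ _ → 1))
          ≡⟨ cong (λ e → rejected + (flagged first n ms + e))
               (≡-trans (sumOver-const n 1) (*-identityˡ (2 ^ n))) ⟩
        rejected + (flagged first n ms + 2 ^ n) ∎
        where
        open ≡-Reasoning
        g : Str → ℕ
        g y = indicator (judge x (iter n (0 , ms , [] , y)))
        split = m≤n⇒∃[o]m+o≡n (≤-trans n≤bs (length-query bs x))
        k = proj₁ split
        L≡ : n + k ≡ length (query bs x)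
        L≡ = proj₂ split
        regroup-two : ∀ n k → 2 + (n + k) ≡ n + (2 + k)
        regroup-two = solve-∀
        inner : ∀ y → length y ≡ n → sumOver (2 + k) (λ q → g (y ++ q)) ≡
          indicator (not (decideR R x y)) + (indicator (isSet (foldl update first (zip y ms))) + 1)
        inner y eq =
          ≡-trans (sumOver-cong (2 + k) (λ q _ → cong indicator (judged q)))
            (≡-trans (sumOver-verdict k (decideR R x) (zip y ms))
              (cong (λ y' → indicator (not (decideR R x y')) +
                            (indicator (isSet (foldl update first (zip y ms))) + 1))
                (map-proj₁-zip y ms y≤ms)))
          where
          y≤ms : length y ≤ length ms
          y≤ms = subst₂ _≤_ (sym eq) (sym (length-reverse bs)) n≤bs
          judged : ∀ q → judge x (iter n (0 , ms , [] , y ++ q)) ≡ verdict (decideR R x) (zip y ms) q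
          judged q = cong (judge x)
            (≡-trans (cong (λ k → iter k (0 , ms , [] , y ++ q)) (sym eq))
              (proj₂ (proj₂ (iter-success y {0} {ms} {[]} {q} y≤ms))))

    majority⇒oracle : 2 ^ n < 2 * accepted → ∃[ bs ] length bs ≡ n × oracle (query bs x)
    majority⇒oracle maj =
      let (ms , len , eq) =
            flagged-surjective n rejected (minority accepted rejected accepted+rejected maj)
          -- Reversed, because the verifier uses the guessed bits from the last to the first.
          bs = reverse ms
          len' = ≡-trans (length-reverse ms) len
      in bs , len' , n ,
         ≡-trans (cong (_+ 1) (≡-trans (count-long bs (≤-reflexive (sym len')))
             (cong (λ ms → rejected + (flagged first n ms + 2 ^ n)) (reverse-involutive ms))))
           (majority⇒power n accepted rejected (flagged first n ms) accepted+rejected eq)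

    oracle⇒majority : ∀ bs → oracle (query bs x) → 2 ^ n < 2 * accepted
    oracle⇒majority bs (t , eq) = [ long , short ]′ (≤-<-connex n (length bs))
      where
      long : n ≤ length bs → 2 ^ n < 2 * accepted
      long n≤bs =
        let (F≤ , F>) = flagged-bounds n (reverse bs) (subst (n ≤_) (sym (length-reverse bs)) n≤bs)
        in power⇒majority n t accepted rejected (flagged first n (reverse bs)) accepted+rejected F≤ F>
             (≡-trans (cong (_+ 1) (sym (count-long bs n≤bs))) eq)
      short : length bs < n → 2 ^ n < 2 * accepted
      short bs<n =
        contradiction (≡-trans (cong (_+ 1) (sym (count-short bs bs<n))) eq)
          (<⇒≢ (^-monoʳ-< 2 (s≤s (s≤s z≤n)) {0} {suc t} (s≤s z≤n)))

theorem4 : (L : Language) → PP L → NP^MNS L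
theorem4 L (p , R , L⇔) =
  oracle , oracle∈MNS , guesser , time , λ x → mk⇔
    (λ Lx →
      let (bs , len , o) = majority⇒oracle x (Equivalence.to (L⇔ x) Lx)
      in Guessing.query⇒accepts oracle x bs o (≤-reflexive (time-eq x bs len)))
    (λ acc →
      let (bs , o) = Guessing.accepts⇒query oracle x acc
      in Equivalence.from (L⇔ x) (oracle⇒majority x bs o))
  where
  open Reduction p R
  time : Poly
  time = (p ⊕ p) ⊕ (3 ∷ 1 ∷ [])
  time-eq : ∀ x bs → length bs ≡ eval p (length x) →
    length bs + length bs + (3 + length x) ≡ eval time (length x)
  time-eq x bs len rewrite eval-⊕ (p ⊕ p) (3 ∷ 1 ∷ []) (length x) | eval-⊕ p p (length x) | len =
    cong (eval p (length x) + eval p (length x) +_) (linear (length x))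
    where
    linear : ∀ m → 3 + m ≡ 3 + m * (1 + m * 0)
    linear = solve-∀
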